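{- Let $c \geq 1$ be a real number and let $G$ be a (possibly infinite) graph whose growth satisfies $f_G(r) \leq cr$ for every positive integer $r$. Then $G$ has stack-number at most $49c^2+30c+1$.
   Context: Graphs are undirected and may be infinite. The growth of a graph $G$ is the function $f_G\colon \mathbb{N}\to\mathbb{N}\cup\{\infty\}$ where $f_G(r)$ is the supremum of $|V(H)|$ over all subgraphs $H$ of $G$ of radius at most $r$. For an integer $k$, a $k$-stack layout of $G$ is a pair $(\leq,\varphi)$ where $\leq$ is a linear ordering of $V(G)$ and $\varphi\colon E(G)\to\{1,\dots,k\}$ is a function such that $\varphi(ux)\neq\varphi(vy)$ for any two edges $ux,vy\in E(G)$ with $u<v<x<y$. The stack-number of $G$ is the minimum integer $k\geq 0$ such that $G$ has a $k$-stack layout, or $\infty$ if no such $k$ exists. -}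

module Defs where

open import Level using (Level; suc)

-- Excluded middle for arbitrary types, which selects an element of every
-- nonempty type, together with function extensionality gives enough choice
-- to well-order the vertices of an arbitrary infinite graph.
open import Axiom.ExcludedMiddle public using (ExcludedMiddle)
open import Axiom.Extensionality.Propositional public using (Extensionality)

open import Data.Empty using (⊥)
open import Data.Fin.Base using (Fin)
import Data.Integer.Base as ℤ
open import Data.Nat.Base as ℕ using (ℕ)
import Data.Nat.Properties as ℕₚ
open import Data.Product.Base using (Σ-syntax; ∃-syntax; _×_; _,_; proj₁; proj₂)
open import Data.Rational.Base as ℚ using (ℚ; 0ℚ; 1ℚ; ½)
import Data.Rational.Properties as ℚₚ
open import Data.Rational.Solver using (module +-*-Solver)
open import Function.Bundles using (_⇔_)
open import Function.Definitions using (Injective)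
open import Relation.Binary.Core using (Rel)
open import Relation.Binary.Structures using (IsTotalOrder)
import Relation.Binary.Construct.Add.Supremum.NonStrict as AddSupremum
import Relation.Binary.Construct.NonStrictToStrict as ToStrict
open import Relation.Binary.PropositionalEquality
  using (_≡_; _≢_; refl; sym; trans; cong; subst)
open import Relation.Nullary.Construct.Add.Supremum using (_⁺; ⊤⁺; [_])
open import Relation.Nullary.Negation.Core using (¬_)
open import Relation.Unary using (Pred)

private
  variable
    ℓ : Level

-- Real numbers, as Cauchy sequences of rationals.  Two sequences
-- represent the same real when each is ≤ᴿ the other.
IsCauchy : (ℕ → ℚ) → Set
IsCauchy x = ∀ ε → 0ℚ ℚ.< ε → ∃[ N ] (∀ m n → N ℕ.≤ m → N ℕ.≤ n →
             ℚ.∣ x m ℚ.- x n ∣ ℚ.< ε)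

record ℝ : Set where
  constructor mkℝ
  field
    seq    : ℕ → ℚ
    cauchy : IsCauchy seq

open ℝ public

infix 4 _≤ᴿ_
_≤ᴿ_ : ℝ → ℝ → Set
x ≤ᴿ y = ∀ ε → 0ℚ ℚ.< ε →
         ∃[ N ] (∀ n → N ℕ.≤ n → seq x n ℚ.≤ seq y n ℚ.+ ε)

fromℕ : ℕ → ℝ
fromℕ k = mkℝ (λ _ → q) λ ε 0<ε → 0 , λ _ _ _ _ →
  subst (ℚ._< ε) (sym (cong ℚ.∣_∣ (ℚₚ.+-inverseʳ q))) 0<ε
  where q = ℤ.+ k ℚ./ 1

private
  module _ where
    open +-*-Solver

    halves : ∀ e → ½ ℚ.* e ℚ.+ ½ ℚ.* e ≡ e
    halves = solve 1 (λ e → con ½ :* e :+ con ½ :* e := e) refl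

    shift : ∀ a b → a ≡ b ℚ.+ (a ℚ.- b)
    shift = solve 2 (λ a b → a := b :+ (a :- b)) refl

    +-regroup : ∀ a b c d →
      (a ℚ.+ b) ℚ.- (c ℚ.+ d) ≡ (a ℚ.- c) ℚ.+ (b ℚ.- d)
    +-regroup = solve 4 (λ a b c d →
      (a :+ b) :- (c :+ d) := (a :- c) :+ (b :- d)) refl

    *-regroup : ∀ a b c d →
      a ℚ.* b ℚ.- c ℚ.* d ≡ (b ℚ.- d) ℚ.* a ℚ.+ (a ℚ.- c) ℚ.* d
    *-regroup = solve 4 (λ a b c d →
      a :* b :- c :* d := (b :- d) :* a :+ (a :- c) :* d) refl

  +-cauchy : ∀ x y → IsCauchy x → IsCauchy y → IsCauchy (λ n → x n ℚ.+ y n)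
  +-cauchy x y cx cy ε 0<ε = M ℕ.⊔ N , λ m n p q →
    let open ℚₚ.≤-Reasoning in begin-strict
    ℚ.∣ (x m ℚ.+ y m) ℚ.- (x n ℚ.+ y n) ∣
      ≡⟨ cong ℚ.∣_∣ (+-regroup (x m) (y m) (x n) (y n)) ⟩
    ℚ.∣ (x m ℚ.- x n) ℚ.+ (y m ℚ.- y n) ∣
      ≤⟨ ℚₚ.∣p+q∣≤∣p∣+∣q∣ (x m ℚ.- x n) (y m ℚ.- y n) ⟩
    ℚ.∣ x m ℚ.- x n ∣ ℚ.+ ℚ.∣ y m ℚ.- y n ∣
      <⟨ ℚₚ.+-mono-<
           (hx m n (ℕₚ.m⊔n≤o⇒m≤o M N p) (ℕₚ.m⊔n≤o⇒m≤o M N q))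
           (hy m n (ℕₚ.m⊔n≤o⇒n≤o M N p) (ℕₚ.m⊔n≤o⇒n≤o M N q)) ⟩
    δ ℚ.+ δ
      ≡⟨ halves ε ⟩
    ε ∎
    where
    δ = ½ ℚ.* ε
    0<δ : 0ℚ ℚ.< δ
    0<δ = subst (ℚ._< δ) (ℚₚ.*-zeroʳ ½) (ℚₚ.*-monoʳ-<-pos ½ 0<ε)
    M = proj₁ (cx δ 0<δ)
    N = proj₁ (cy δ 0<δ)
    hx = proj₂ (cx δ 0<δ)
    hy = proj₂ (cy δ 0<δ)

  eventually-bounded : ∀ x → IsCauchy x →
    ∃[ B ] (0ℚ ℚ.< B × ∃[ N ] (∀ n → N ℕ.≤ n → ℚ.∣ x n ∣ ℚ.≤ B))
  eventually-bounded x cx = B , 0<B , N , bound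
    where
    0<1 : 0ℚ ℚ.< 1ℚ
    0<1 = ℚₚ.positive⁻¹ 1ℚ
    N = proj₁ (cx 1ℚ 0<1)
    B = ℚ.∣ x N ∣ ℚ.+ 1ℚ
    0<B : 0ℚ ℚ.< B
    0<B = ℚₚ.+-mono-≤-< (ℚₚ.0≤∣p∣ (x N)) 0<1
    bound : ∀ n → N ℕ.≤ n → ℚ.∣ x n ∣ ℚ.≤ B
    bound n p = let open ℚₚ.≤-Reasoning in begin
      ℚ.∣ x n ∣
        ≡⟨ cong ℚ.∣_∣ (shift (x n) (x N)) ⟩
      ℚ.∣ x N ℚ.+ (x n ℚ.- x N) ∣
        ≤⟨ ℚₚ.∣p+q∣≤∣p∣+∣q∣ (x N) (x n ℚ.- x N) ⟩
      ℚ.∣ x N ∣ ℚ.+ ℚ.∣ x n ℚ.- x N ∣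
        ≤⟨ ℚₚ.+-monoʳ-≤ ℚ.∣ x N ∣
             (ℚₚ.<⇒≤ (proj₂ (cx 1ℚ 0<1) n N p ℕₚ.≤-refl)) ⟩
      B ∎

  *-small : ∀ d z {D δ} → 0ℚ ℚ.< D → ℚ.∣ z ∣ ℚ.≤ D → ℚ.∣ d ∣ ℚ.< δ →
            ℚ.∣ d ℚ.* z ∣ ℚ.< δ ℚ.* D
  *-small d z {D} {δ} 0<D z≤D d<δ =
    subst (ℚ._< δ ℚ.* D) (sym (ℚₚ.∣p*q∣≡∣p∣*∣q∣ d z))
      (ℚₚ.≤-<-trans
        (ℚₚ.*-monoˡ-≤-nonNeg ℚ.∣ d ∣ {{ℚₚ.∣-∣-nonNeg d}} z≤D)
        (ℚₚ.*-monoˡ-<-pos D {{ℚ.positive 0<D}} d<δ))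

  *-estimate : ∀ a b c d {A B δ} → 0ℚ ℚ.< A → 0ℚ ℚ.< B →
    ℚ.∣ a ∣ ℚ.≤ A → ℚ.∣ d ∣ ℚ.≤ B →
    ℚ.∣ a ℚ.- c ∣ ℚ.< δ → ℚ.∣ b ℚ.- d ∣ ℚ.< δ →
    ℚ.∣ a ℚ.* b ℚ.- c ℚ.* d ∣ ℚ.< δ ℚ.* A ℚ.+ δ ℚ.* B
  *-estimate a b c d {A} {B} {δ} 0<A 0<B a≤A d≤B a-c b-d =
    subst (λ t → ℚ.∣ t ∣ ℚ.< δ ℚ.* A ℚ.+ δ ℚ.* B) (sym (*-regroup a b c d))
      (ℚₚ.≤-<-trans
        (ℚₚ.∣p+q∣≤∣p∣+∣q∣ ((b ℚ.- d) ℚ.* a) ((a ℚ.- c) ℚ.* d))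
        (ℚₚ.+-mono-<
          (*-small (b ℚ.- d) a 0<A a≤A b-d)
          (*-small (a ℚ.- c) d 0<B d≤B a-c)))

  scale : ∀ ε C → 0ℚ ℚ.< ε → 0ℚ ℚ.< C → ∃[ δ ] (0ℚ ℚ.< δ × δ ℚ.* C ≡ ε)
  scale ε C 0<ε 0<C = ε ℚ.* C⁻¹ , 0<δ , eq
    where
    C>0 : ℚ.Positive C
    C>0 = ℚ.positive 0<C
    C≢0 : ℚ.NonZero C
    C≢0 = ℚₚ.pos⇒nonZero C {{C>0}}
    C⁻¹ = (ℚ.1/ C) {{C≢0}}
    0<δ : 0ℚ ℚ.< ε ℚ.* C⁻¹
    0<δ = subst (ℚ._< ε ℚ.* C⁻¹) (ℚₚ.*-zeroˡ C⁻¹)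
      (ℚₚ.*-monoˡ-<-pos C⁻¹ {{ℚₚ.1/pos⇒pos C {{C>0}}}} 0<ε)
    eq : ε ℚ.* C⁻¹ ℚ.* C ≡ ε
    eq = trans (ℚₚ.*-assoc ε C⁻¹ C)
      (trans (cong (ε ℚ.*_) (ℚₚ.*-inverseˡ C {{C≢0}})) (ℚₚ.*-identityʳ ε))

  *-cauchy : ∀ x y → IsCauchy x → IsCauchy y → IsCauchy (λ n → x n ℚ.* y n)
  *-cauchy x y cx cy ε 0<ε =
    let A , 0<A , K , hA = eventually-bounded x cx
        B , 0<B , L , hB = eventually-bounded y cy
        δ , 0<δ , δC≡ε   = scale ε (A ℚ.+ B) 0<ε (ℚₚ.+-mono-< 0<A 0<B)
        M , hx = cx δ 0<δ
        N , hy = cy δ 0<δ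
        KL = K ℕ.⊔ L
        MN = M ℕ.⊔ N
    in KL ℕ.⊔ MN , λ m n p q →
      subst (ℚ.∣ x m ℚ.* y m ℚ.- x n ℚ.* y n ∣ ℚ.<_)
        (trans (sym (ℚₚ.*-distribˡ-+ δ A B)) δC≡ε)
        (*-estimate (x m) (y m) (x n) (y n) 0<A 0<B
          (hA m (ℕₚ.m⊔n≤o⇒m≤o K L (ℕₚ.m⊔n≤o⇒m≤o KL MN p)))
          (hB n (ℕₚ.m⊔n≤o⇒n≤o K L (ℕₚ.m⊔n≤o⇒m≤o KL MN q)))
          (hx m n (ℕₚ.m⊔n≤o⇒m≤o M N (ℕₚ.m⊔n≤o⇒n≤o KL MN p))
                  (ℕₚ.m⊔n≤o⇒m≤o M N (ℕₚ.m⊔n≤o⇒n≤o KL MN q)))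
          (hy m n (ℕₚ.m⊔n≤o⇒n≤o M N (ℕₚ.m⊔n≤o⇒n≤o KL MN p))
                  (ℕₚ.m⊔n≤o⇒n≤o M N (ℕₚ.m⊔n≤o⇒n≤o KL MN q))))

infixl 6 _+ᴿ_
_+ᴿ_ : ℝ → ℝ → ℝ
x +ᴿ y = mkℝ (λ n → seq x n ℚ.+ seq y n) (+-cauchy (seq x) (seq y) (cauchy x) (cauchy y))

infixl 7 _*ᴿ_
_*ᴿ_ : ℝ → ℝ → ℝ
x *ᴿ y = mkℝ (λ n → seq x n ℚ.* seq y n) (*-cauchy (seq x) (seq y) (cauchy x) (cauchy y))

ℕ∞ : Set
ℕ∞ = ℕ ⁺

open AddSupremum ℕ._≤_ public using () renaming (_≤⁺_ to _≤∞_)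

infix 4 _≤∞ᴿ_
_≤∞ᴿ_ : ℕ∞ → ℝ → Set
[ n ] ≤∞ᴿ x = fromℕ n ≤ᴿ x
⊤⁺    ≤∞ᴿ x = ⊥

IsSupremum : Pred ℕ∞ ℓ → ℕ∞ → Set ℓ
IsSupremum S s = (∀ n → S n → n ≤∞ s) ×
                 (∀ b → (∀ n → S n → n ≤∞ b) → s ≤∞ b)

-- The vertex set of a subgraph is a type-valued predicate, so its
-- elements, not its proofs, have to be counted.
HasCardinality : {V : Set ℓ} → Pred V ℓ → ℕ∞ → Set ℓ
HasCardinality {V = V} P [ n ] =
  Σ[ e ∈ (Fin n → V) ] (Injective _≡_ _≡_ e × (∀ v → P v ⇔ (∃[ i ] e i ≡ v)))
HasCardinality P ⊤⁺ = ∀ n → ¬ HasCardinality P [ n ]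

record Graph (ℓ : Level) : Set (suc ℓ) where
  field
    Vertex     : Set ℓ
    Adj        : Rel Vertex ℓ
    Adj-sym    : ∀ {u v} → Adj u v → Adj v u
    Adj-irrefl : ∀ {v} → ¬ Adj v v

record Subgraph (G : Graph ℓ) : Set (suc ℓ) where
  open Graph G
  field
    InV   : Pred Vertex ℓ
    InE   : Rel Vertex ℓ
    E-sym : ∀ {u v} → InE u v → InE v u
    E⊆Adj : ∀ {u v} → InE u v → Adj u v
    E⊆V×V : ∀ {u v} → InE u v → InV u × InV v

data Walk {V : Set ℓ} (E : Rel V ℓ) : ℕ → V → V → Set ℓ where
  nil  : ∀ {v} → Walk E 0 v v
  cons : ∀ {n u v w} → E u v → Walk E n v w → Walk E (ℕ.suc n) u w

module _ {G : Graph ℓ} where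
  open Graph G

  DistanceAtMost : Subgraph G → ℕ → Rel Vertex ℓ
  DistanceAtMost H r u v = ∃[ n ] (n ℕ.≤ r × Walk (Subgraph.InE H) n u v)

  RadiusAtMost : Subgraph G → ℕ → Set ℓ
  RadiusAtMost H r =
    ∃[ v ] (InV v × (∀ w → InV w → DistanceAtMost H r v w))
    where open Subgraph H

IsGrowth : Graph ℓ → (ℕ → ℕ∞) → Set (suc ℓ)
IsGrowth G f = ∀ r → IsSupremum
  (λ n → Σ[ H ∈ Subgraph G ]
           (RadiusAtMost H r × HasCardinality (Subgraph.InV H) n))
  (f r)

-- An edge is represented by adjacency proofs in both directions;
-- φ-edge makes φ depend only on the unordered pair {u , v}.
record StackLayout (G : Graph ℓ) (k : ℕ) : Set (suc ℓ) where
  open Graph G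
  field
    _≼_          : Rel Vertex ℓ
    isTotalOrder : IsTotalOrder _≡_ _≼_
    φ            : ∀ {u v} → Adj u v → Fin k
    φ-edge       : ∀ {u v} (e : Adj u v) (e′ : Adj v u) → φ e ≡ φ e′

  open ToStrict _≡_ _≼_ public using () renaming (_<_ to _≺_)

  field
    noCrossing   : ∀ {u v x y} (ux : Adj u x) (vy : Adj v y) →
                   u ≺ v → v ≺ x → x ≺ y → φ ux ≢ φ vy

IsStackNumber : Graph ℓ → ℕ∞ → Set (suc ℓ)
IsStackNumber G [ k ] = StackLayout G k × (∀ j → StackLayout G j → k ℕ.≤ j)
IsStackNumber G ⊤⁺    = ∀ k → ¬ StackLayout G k

-- Let C be an integer with f_G(r) ≤ Cr and let s = 2C.  In a subgraph P, take
-- a smallest ball containing at least s vertices of a given set W, say of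
-- radius R.  The concentric ball of radius 2R is covered by 5C balls of smaller
-- radius, as these can be packed at half their radius and connected balls of
-- radius h have more than h vertices; hence it contains at most 5Cs vertices of
-- W.  It has at most 2CR vertices, so one of its R outermost spheres has at most
-- s.  If |W| = 5Cs + s, this sphere S leaves at least s vertices of W on either
-- side, so both sides together with S meet W ∪ S in at most |W| vertices, and one
-- can recurse.  This yields a tree-decomposition with bags of size at most
-- K = 5Cs + 2s = 10C² + 4C.
--
-- Colour the vertices with K colours so that every bag is rainbow, order them by
-- a depth-first traversal, and give each edge the colour of its first end.  Two
-- crossing edges then have first ends in a common bag, so their colours differ.
--
-- Infinite graphs follow by compactness, with an ultrafilter on the finite sets
-- of vertices.  Finally C can be chosen with C ≤ c + 1 + ε, which makes K at most
-- 49c² + 30c + 1 as c ≥ 1.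

module Submission where

open import Defs
open import Level using (Level; 0ℓ; Lift; lift; lower)
open import Axiom.Extensionality.Propositional using (lower-extensionality)
open import Data.Bool.Base using (Bool; true; false; not; if_then_else_)
import Data.Bool.Properties as Boolₚ
open import Data.Empty using (⊥; ⊥-elim)
open import Data.Fin.Base using (Fin; zero; suc; fromℕ<)
import Data.Fin.Properties as Finₚ
open import Data.Fin.Subset as Subset hiding (⊥; ⊤; Lift)
open import Data.Fin.Subset.Properties
import Data.Integer.Base as ℤ
import Data.Integer.Properties as ℤₚ
open import Data.List.Base as List using (List; []; _∷_; _++_)
open import Data.List.Membership.Propositional using () renaming (_∈_ to _∈ₗ_)
open import Data.List.Membership.Propositional.Properties
  using (∈-++⁺ˡ; ∈-++⁺ʳ; ∈-lookup; ∈-deduplicate⁺)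
open import Data.List.Relation.Binary.Subset.Propositional using () renaming (_⊆_ to _⊆ₗ_)
open import Data.List.Relation.Unary.All as All using (All; []; _∷_)
import Data.List.Relation.Unary.All.Properties as Allₚ
open import Data.List.Relation.Unary.AllPairs using ([]; _∷_)
open import Data.List.Relation.Unary.Any as Any using (here; there)
open import Data.List.Relation.Unary.Any.Properties using (lookup-index)
open import Data.List.Relation.Unary.Unique.DecPropositional.Properties using (deduplicate-!)
open import Data.List.Relation.Unary.Unique.Propositional using (Unique)
open import Data.Maybe.Base using (Maybe; just; nothing; maybe′)
open import Data.Nat.Base using (ℕ; zero; suc; _+_; _*_; _⊔_; _≤_; _<_; z≤n; s≤s; ⌊_/2⌋)
import Data.Nat.Coprimality as Coprime
import Data.Nat.Properties as ℕₚ
import Data.Nat.Solver as ℕ-Solver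
open import Data.Product.Base using (∃-syntax; Σ-syntax; _×_; _,_; proj₁; proj₂)
open import Data.Rational.Base as ℚ using (ℚ; mkℚ; 0ℚ; 1ℚ; ½)
import Data.Rational.Properties as ℚₚ
import Data.Rational.Solver as ℚ-Solver
open import Data.Sum.Base as Sum using (_⊎_; inj₁; inj₂; [_,_]′)
open import Data.Vec.Base using ([]; _∷_; tabulate; here; there)
open import Data.Vec.Properties using ([]=⇒lookup; lookup⇒[]=; lookup∘tabulate)
open import Function.Base using (_∘_; case_of_)
open import Function.Bundles using (mk⇔)
open import Function.Definitions using (Injective)
open import Relation.Binary.Construct.Add.Supremum.NonStrict _≤_ using ([≤]-injective)
open import Relation.Binary.PropositionalEquality hiding ([_])
open import Relation.Binary.Structures using (IsTotalOrder)
open import Relation.Nullary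
open import Relation.Nullary.Construct.Add.Supremum using ([_])
open import Relation.Nullary.Decidable using (dec-true; dec-false; decidable-stable; map′)

private
  variable
    ℓ : Level
    n : ℕ

-- Cardinalities of finite subsets.

∣p∩q∣+∣p─q∣≡∣p∣ : ∀ (p q : Subset n) → ∣ p ∩ q ∣ + ∣ p ─ q ∣ ≡ ∣ p ∣
∣p∩q∣+∣p─q∣≡∣p∣ []            []            = refl
∣p∩q∣+∣p─q∣≡∣p∣ (outside ∷ p) (inside ∷ q)  = ∣p∩q∣+∣p─q∣≡∣p∣ p q
∣p∩q∣+∣p─q∣≡∣p∣ (outside ∷ p) (outside ∷ q) = ∣p∩q∣+∣p─q∣≡∣p∣ p q
∣p∩q∣+∣p─q∣≡∣p∣ (inside ∷ p)  (inside ∷ q)  = cong suc (∣p∩q∣+∣p─q∣≡∣p∣ p q)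
∣p∩q∣+∣p─q∣≡∣p∣ (inside ∷ p)  (outside ∷ q) =
  trans (ℕₚ.+-suc _ _) (cong suc (∣p∩q∣+∣p─q∣≡∣p∣ p q))

x∈p─q⇒x∉q : ∀ {x} (p q : Subset n) → x ∈ p ─ q → x ∉ q
x∈p─q⇒x∉q (inside ∷ p)  (outside ∷ q) here      ()
x∈p─q⇒x∉q (_ ∷ p)       (_ ∷ q)       (there i) (there j) = x∈p─q⇒x∉q p q i j

∣p∪q∣≤∣p∣+∣q∣ : ∀ (p q : Subset n) → ∣ p ∪ q ∣ ≤ ∣ p ∣ + ∣ q ∣
∣p∪q∣≤∣p∣+∣q∣ p q = subst (_≤ ∣ p ∣ + ∣ q ∣) (∣p∩q∣+∣p─q∣≡∣p∣ (p ∪ q) p)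
  (ℕₚ.+-mono-≤ (∣p∩q∣≤∣q∣ (p ∪ q) p) (p⊆q⇒∣p∣≤∣q∣ λ i →
    [ (λ j → contradiction j (x∈p─q⇒x∉q (p ∪ q) p i)) , (λ j → j) ]′
      (x∈p∪q⁻ p q (p─q⊆p (p ∪ q) p i))))

disjoint⇒∣p∣+∣q∣≤∣t∣ : ∀ {p q t : Subset n} → p ⊆ t → q ⊆ t →
  (∀ {x} → x ∈ p → x ∉ q) → ∣ p ∣ + ∣ q ∣ ≤ ∣ t ∣
disjoint⇒∣p∣+∣q∣≤∣t∣ {p = p} {q} {t} p⊆t q⊆t dis =
  subst (∣ p ∣ + ∣ q ∣ ≤_) (∣p∩q∣+∣p─q∣≡∣p∣ t p)
    (ℕₚ.+-mono-≤ (p⊆q⇒∣p∣≤∣q∣ λ i → x∈p∩q⁺ (p⊆t i , i))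
                 (p⊆q⇒∣p∣≤∣q∣ λ j → x∈p∧x∉q⇒x∈p─q (q⊆t j) λ i → dis i j))

⊈⇒∃ : ∀ {p q : Subset n} → p ⊈ q → ∃[ x ] (x ∈ p × x ∉ q)
⊈⇒∃ {p = p} {q} p⊈q with nonempty? (p ─ q)
... | yes (x , i) = x , p─q⊆p p q i , x∈p─q⇒x∉q p q i
... | no none     = contradiction
  (λ {x} i → case x ∈? q of λ where
    (yes j) → j
    (no j)  → contradiction (x , x∈p∧x∉q⇒x∈p─q i j) none) p⊈q

0<∣p∣⇒nonempty : ∀ (p : Subset n) → 0 < ∣ p ∣ → Nonempty p
0<∣p∣⇒nonempty {n} p 0<∣p∣ with nonempty? p
... | yes ne = ne
... | no e   = contradiction (trans (cong ∣_∣ (Empty-unique e)) (∣⊥∣≡0 n)) (ℕₚ.>⇒≢ 0<∣p∣)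

injection⇒≤∣p∣ : ∀ {k} (p : Subset n) (g : Fin k → Fin n) → Injective _≡_ _≡_ g →
  (∀ i → g i ∈ p) → k ≤ ∣ p ∣
injection⇒≤∣p∣ {k = zero}  p g inj g∈p = z≤n
injection⇒≤∣p∣ {k = suc k} p g inj g∈p = ℕₚ.≤-trans
  (s≤s (injection⇒≤∣p∣ (p - g zero) (g ∘ suc) (Finₚ.suc-injective ∘ inj)
    λ i → x∈p∧x≢y⇒x∈p-y (g∈p (suc i)) λ eq → case inj eq of λ ()))
  (x∈p⇒∣p-x∣<∣p∣ (g∈p zero))

enumerate : ∀ (p : Subset n) → Σ[ e ∈ (Fin ∣ p ∣ → Fin n) ]
  (Injective _≡_ _≡_ e × (∀ i → e i ∈ p) × (∀ {x} → x ∈ p → ∃[ i ] e i ≡ x))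
enumerate [] = (λ ()) , (λ { {()} }) , (λ ()) , λ ()
enumerate (outside ∷ p) = let e , inj , e∈p , surj = enumerate p in
  suc ∘ e , inj ∘ Finₚ.suc-injective , (λ i → there (e∈p i)) ,
  λ { (there i) → let j , eq = surj i in j , cong suc eq }
enumerate {suc n} (inside ∷ p) = e′ , inj′ , e′∈p , surj′
  where
  rec = enumerate p
  e = proj₁ rec
  e′ : Fin (suc ∣ p ∣) → Fin (suc n)
  e′ zero    = zero
  e′ (suc i) = suc (e i)
  inj′ : Injective _≡_ _≡_ e′
  inj′ {zero}  {zero}  eq = refl
  inj′ {suc i} {suc j} eq = cong suc (proj₁ (proj₂ rec) (Finₚ.suc-injective eq))
  e′∈p : ∀ i → e′ i ∈ inside ∷ p
  e′∈p zero    = here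
  e′∈p (suc i) = there (proj₁ (proj₂ (proj₂ rec)) i)
  surj′ : ∀ {x} → x ∈ inside ∷ p → ∃[ i ] e′ i ≡ x
  surj′ here      = zero , refl
  surj′ (there i) = let j , eq = proj₂ (proj₂ (proj₂ rec)) i in suc j , cong suc eq

-- If every colour occurred on `p`, choosing one vertex of each colour would inject the colours into
-- `p`.
fresh : ∀ {k} (p : Subset n) (χ : Fin n → Fin k) → ∣ p ∣ < k →
  ∃[ i ] (∀ {x} → x ∈ p → χ x ≢ i)
fresh {k = k} p χ ∣p∣<k with Finₚ.any? (λ i → ¬? (Finₚ.any? λ x → x ∈? p ×-dec (χ x Finₚ.≟ i)))
... | yes (i , unused) = i , λ x∈p eq → unused (_ , x∈p , eq)
... | no none = contradiction
  (injection⇒≤∣p∣ p (proj₁ ∘ used)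
    (λ {i} {j} eq → trans (sym (proj₂ (proj₂ (used i))))
      (trans (cong χ eq) (proj₂ (proj₂ (used j)))))
    (proj₁ ∘ proj₂ ∘ used))
  (ℕₚ.<⇒≱ ∣p∣<k)
  where
  used : ∀ i → ∃[ x ] (x ∈ p × χ x ≡ i)
  used i = decidable-stable (Finₚ.any? λ x → x ∈? p ×-dec (χ x Finₚ.≟ i)) λ nu → none (i , nu)

-- Separators and layouts of finite graphs

module FiniteGraph {n} (Adj : Fin n → Fin n → Set ℓ) (adj? : ∀ u v → Dec (Adj u v))
  (adj-sym : ∀ {u v} → Adj u v → Adj v u) where

  -- One may think of a derivation of Elim P W as a tree-decomposition of the
  -- subgraph induced by P, with bags of size at most K and root bag W.
  data Elim (K : ℕ) (P W : Subset n) : Set ℓ where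
    done  : P ⊆ W → Elim K P W
    add   : ∀ {w} → w ∈ P → w ∉ W → ∣ W ∣ < K → Elim K P (W ∪ ⁅ w ⁆) → Elim K P W
    split : ∀ {A B} → A ⊆ P → B ⊆ P → (∀ {x} → x ∈ P → x ∈ A ⊎ x ∈ B) → A ∩ B ⊆ W →
            (∀ {x y} → x ∈ A → x ∉ B → y ∈ B → y ∉ A → ¬ Adj x y) →
            Elim K A (W ∩ A) → Elim K B (W ∩ B) → Elim K P W

  -- The vertices of W come first, in any order, and have colours χ₀.
  record Layout {K} (P W : Subset n) (χ₀ : Fin n → Fin K) : Set ℓ where
    field
      pos     : Fin n → ℕ
      bound   : ℕ
      pos<    : ∀ {x} → x ∈ P → x ∉ W → pos x < bound
      pos-inj : ∀ {x y} → x ∈ P → x ∉ W → y ∈ P → y ∉ W → pos x ≡ pos y → x ≡ y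
      χ       : Fin n → Fin K
      agree   : ∀ {x} → x ∈ W → χ x ≡ χ₀ x
      -- Only `u` may lie in `W`: if `v` did, then so would `u`, and two vertices of the rainbow set
      -- `W` never share a colour.
      good    : ∀ {u v x y} → u ∈ P → v ∈ P → v ∉ W → x ∈ P → x ∉ W → y ∈ P → y ∉ W →
                u ∈ W ⊎ pos u < pos v → pos v < pos x → pos x < pos y →
                Adj u x → Adj v y → χ u ≢ χ v

  module Add {K P W} (W⊆P : W ⊆ P) (χ₀ : Fin n → Fin K)
    (inj : ∀ {x y} → x ∈ W → y ∈ W → χ₀ x ≡ χ₀ y → x ≡ y)
    {w} (w∈P : w ∈ P) (w∉W : w ∉ W) (∣W∣<K : ∣ W ∣ < K) where

    c = proj₁ (fresh W χ₀ ∣W∣<K)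
    c-fresh = proj₂ (fresh W χ₀ ∣W∣<K)
    W′ = W ∪ ⁅ w ⁆

    χ₁ : Fin n → Fin K
    χ₁ x = if does (x Finₚ.≟ w) then c else χ₀ x

    χ₁-old : ∀ {x} → x ≢ w → χ₁ x ≡ χ₀ x
    χ₁-old {x} x≢w = cong (if_then c else χ₀ x) (dec-false (x Finₚ.≟ w) x≢w)

    χ₁-new : χ₁ w ≡ c
    χ₁-new = cong (if_then c else χ₀ w) (dec-true (w Finₚ.≟ w) refl)

    W′-view : ∀ {x} → x ∈ W′ → x ∈ W × x ≢ w ⊎ x ≡ w
    W′-view i with x∈p∪q⁻ W ⁅ w ⁆ i
    ... | inj₁ x∈W = inj₁ (x∈W , λ { refl → w∉W x∈W })
    ... | inj₂ x∈w = inj₂ (x∈⁅y⁆⇒x≡y w x∈w)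

    ∉W′ : ∀ {x} → x ∉ W → x ≢ w → x ∉ W′
    ∉W′ x∉W x≢w i = [ x∉W ∘ proj₁ , x≢w ]′ (W′-view i)

    inj₁′ : ∀ {x y} → x ∈ W′ → y ∈ W′ → χ₁ x ≡ χ₁ y → x ≡ y
    inj₁′ i j eq with W′-view i | W′-view j
    ... | inj₁ (i′ , x≢w) | inj₁ (j′ , y≢w) =
      inj i′ j′ (trans (sym (χ₁-old x≢w)) (trans eq (χ₁-old y≢w)))
    ... | inj₁ (i′ , x≢w) | inj₂ refl =
      contradiction (trans (sym (χ₁-old x≢w)) (trans eq χ₁-new)) (c-fresh i′)
    ... | inj₂ refl | inj₁ (j′ , y≢w) =
      contradiction (trans (sym (χ₁-old y≢w)) (trans (sym eq) χ₁-new)) (c-fresh j′)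
    ... | inj₂ refl | inj₂ refl = refl

    w∈W′ : w ∈ W′
    w∈W′ = x∈p∪q⁺ (inj₂ (x∈⁅x⁆ w))

    W′⊆P : W′ ⊆ P
    W′⊆P i = [ W⊆P ∘ proj₁ , (λ { refl → w∈P }) ]′ (W′-view i)

    module _ (layout : Layout P W′ χ₁) where

      private module L = Layout layout

      pos : Fin n → ℕ
      pos x = if does (x Finₚ.≟ w) then 0 else suc (L.pos x)

      pos< : ∀ {x} → x ∈ P → x ∉ W → pos x < suc L.bound
      pos< {x} i j with x Finₚ.≟ w
      ... | yes _   = s≤s z≤n
      ... | no x≢w  = s≤s (L.pos< i (∉W′ j x≢w))

      pos-inj : ∀ {x y} → x ∈ P → x ∉ W → y ∈ P → y ∉ W → pos x ≡ pos y → x ≡ y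
      pos-inj {x} {y} i j k l eq with x Finₚ.≟ w | y Finₚ.≟ w
      ... | yes p  | yes q  = trans p (sym q)
      ... | no x≢w | no y≢w = L.pos-inj i (∉W′ j x≢w) k (∉W′ l y≢w) (ℕₚ.suc-injective eq)

      pos-view : ∀ {x y} → pos x < pos y → y ≢ w × (x ≡ w ⊎ x ≢ w × L.pos x < L.pos y)
      pos-view {x} {y} lt with x Finₚ.≟ w | y Finₚ.≟ w
      ... | yes p | no q = q , inj₁ p
      ... | no p  | no q = q , inj₂ (p , ℕₚ.≤-pred lt)

      earlier : ∀ {u v} → u ∈ W ⊎ pos u < pos v → u ∈ W′ ⊎ L.pos u < L.pos v
      earlier (inj₁ i) = inj₁ (x∈p∪q⁺ (inj₁ i))
      earlier {u} {v} (inj₂ lt) with pos-view {u} {v} lt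
      ... | _ , inj₁ refl    = inj₁ w∈W′
      ... | _ , inj₂ (_ , q) = inj₂ q

      good : ∀ {u v x y} → u ∈ P → v ∈ P → v ∉ W → x ∈ P → x ∉ W → y ∈ P → y ∉ W →
             u ∈ W ⊎ pos u < pos v → pos v < pos x → pos x < pos y →
             Adj u x → Adj v y → L.χ u ≢ L.χ v
      good {u} {v} {x} {y} u∈P v∈P v∉W x∈P x∉W y∈P y∉W u≺v v≺x x≺y ux vy eq
        with pos-view {v} {x} v≺x | pos-view {x} {y} x≺y
      ... | x≢w , _ | y≢w , inj₁ x≡w = x≢w x≡w
      ... | x≢w , inj₂ (v≢w , v<x) | y≢w , inj₂ (_ , x<y) =
        L.good u∈P v∈P (∉W′ v∉W v≢w) x∈P (∉W′ x∉W x≢w) y∈P (∉W′ y∉W y≢w)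
          (earlier u≺v) v<x x<y ux vy eq
      ... | x≢w , inj₁ refl | y≢w , inj₂ _ = case u≺v of λ where
        (inj₁ i)  → c-fresh i (trans (sym (χ₁-old λ { refl → w∉W i }))
                      (trans (sym (L.agree (x∈p∪q⁺ (inj₁ i))))
                        (trans eq (trans (L.agree w∈W′) χ₁-new))))
        (inj₂ lt) → proj₁ (pos-view {u} {v} lt) refl

      extend : Layout P W χ₀
      extend = record
        { pos     = pos
        ; bound   = suc L.bound
        ; pos<    = λ {x} → pos< {x}
        ; pos-inj = pos-inj
        ; χ       = L.χ
        ; agree   = λ i → trans (L.agree (x∈p∪q⁺ (inj₁ i))) (χ₁-old λ { refl → w∉W i })
        ; good    = good
        }

  -- All of `A` outside `W` precedes all of `B` outside `W`. The two sides meet only inside `W`,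
  -- where both colourings are `χ₀`, so they glue.
  module Split {K P W} (W⊆P : W ⊆ P) (χ₀ : Fin n → Fin K)
    {A B} (A⊆P : A ⊆ P) (B⊆P : B ⊆ P) (cov : ∀ {x} → x ∈ P → x ∈ A ⊎ x ∈ B) (A∩B⊆W : A ∩ B ⊆ W)
    (sep : ∀ {x y} → x ∈ A → x ∉ B → y ∈ B → y ∉ A → ¬ Adj x y)
    (layoutA : Layout A (W ∩ A) χ₀) (layoutB : Layout B (W ∩ B) χ₀) where

    private
      module LA = Layout layoutA
      module LB = Layout layoutB

    pos : Fin n → ℕ
    pos x = if does (x ∈? A) then LA.pos x else LA.bound + LB.pos x

    χ : Fin n → Fin K
    χ x = if does (x ∈? A) then LA.χ x else LB.χ x

    ∉∩ : ∀ {x} Q → x ∉ W → x ∉ W ∩ Q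
    ∉∩ Q x∉W = x∉W ∘ p∩q⊆p W Q

    ∈B : ∀ {x} → x ∈ P → x ∉ A → x ∈ B
    ∈B x∈P x∉A = [ (λ i → contradiction i x∉A) , (λ j → j) ]′ (cov x∈P)

    ∉B : ∀ {x} → x ∉ W → x ∈ A → x ∉ B
    ∉B x∉W i j = x∉W (A∩B⊆W (x∈p∩q⁺ (i , j)))

    χ-A : ∀ {x} → x ∈ A → χ x ≡ LA.χ x
    χ-A {x} i = cong (if_then LA.χ x else LB.χ x) (dec-true (x ∈? A) i)

    χ-B : ∀ {x} → x ∈ B → χ x ≡ LB.χ x
    χ-B {x} j with x ∈? A
    ... | no _  = refl
    ... | yes i = let x∈W = A∩B⊆W (x∈p∩q⁺ (i , j)) in
      trans (LA.agree (x∈p∩q⁺ (x∈W , i))) (sym (LB.agree (x∈p∩q⁺ (x∈W , j))))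

    agree : ∀ {x} → x ∈ W → χ x ≡ χ₀ x
    agree {x} x∈W with x ∈? A
    ... | yes i = LA.agree (x∈p∩q⁺ (x∈W , i))
    ... | no i  = LB.agree (x∈p∩q⁺ (x∈W , ∈B (W⊆P x∈W) i))

    pos< : ∀ {x} → x ∈ P → x ∉ W → pos x < LA.bound + LB.bound
    pos< {x} x∈P x∉W with x ∈? A
    ... | yes i = ℕₚ.<-≤-trans (LA.pos< i (∉∩ A x∉W)) (ℕₚ.m≤m+n _ _)
    ... | no i  = ℕₚ.+-monoʳ-< LA.bound (LB.pos< (∈B x∈P i) (∉∩ B x∉W))

    clash : ∀ {x} → x ∈ A → x ∉ W → ∀ {m} → ¬ (LA.bound + m ≤ LA.pos x)
    clash i x∉W {m} le = ℕₚ.<⇒≱ (LA.pos< i (∉∩ A x∉W)) (ℕₚ.≤-trans (ℕₚ.m≤m+n LA.bound m) le)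

    pos-inj : ∀ {x y} → x ∈ P → x ∉ W → y ∈ P → y ∉ W → pos x ≡ pos y → x ≡ y
    pos-inj {x} {y} x∈P x∉W y∈P y∉W eq with x ∈? A | y ∈? A
    ... | yes i | yes j = LA.pos-inj i (∉∩ A x∉W) j (∉∩ A y∉W) eq
    ... | yes i | no j  = contradiction (ℕₚ.≤-reflexive (sym eq)) (clash i x∉W)
    ... | no i  | yes j = contradiction (ℕₚ.≤-reflexive eq) (clash j y∉W)
    ... | no i  | no j  = LB.pos-inj (∈B x∈P i) (∉∩ B x∉W) (∈B y∈P j) (∉∩ B y∉W)
                            (ℕₚ.+-cancelˡ-≡ LA.bound _ _ eq)

    data Before (x y : Fin n) : Set where
      AA : x ∈ A → y ∈ A → LA.pos x < LA.pos y → Before x y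
      AB : x ∈ A → y ∉ A → Before x y
      BB : x ∉ A → y ∉ A → LB.pos x < LB.pos y → Before x y

    before : ∀ {x y} → y ∉ W → pos x < pos y → Before x y
    before {x} {y} y∉W lt with x ∈? A | y ∈? A
    ... | yes i | yes j = AA i j lt
    ... | yes i | no j  = AB i j
    ... | no i  | yes j = contradiction (ℕₚ.<⇒≤ lt) (clash j y∉W)
    ... | no i  | no j  = BB i j (ℕₚ.+-cancelˡ-< LA.bound _ _ lt)

    -- The edge `vy` forces `v` and `y` onto the same side, hence also `x`, which lies between them;
    -- `u` is adjacent to `x` and so belongs to that side too. The crossing thus already occurs in
    -- `A` or in `B`.
    good : ∀ {u v x y} → u ∈ P → v ∈ P → v ∉ W → x ∈ P → x ∉ W → y ∈ P → y ∉ W →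
           u ∈ W ⊎ pos u < pos v → pos v < pos x → pos x < pos y →
           Adj u x → Adj v y → χ u ≢ χ v
    good {u} {v} {x} {y} u∈P v∈P v∉W x∈P x∉W y∈P y∉W u≺v v≺x x≺y ux vy eq
      with before x∉W v≺x | before y∉W x≺y
    ... | AA v∈A x∈A v<x | AA _ y∈A x<y =
      LA.good u∈A v∈A (∉∩ A v∉W) x∈A (∉∩ A x∉W) y∈A (∉∩ A y∉W)
        (u≺′v u≺v) v<x x<y ux vy (trans (sym (χ-A u∈A)) (trans eq (χ-A v∈A)))
      where
      u∈A : u ∈ A
      u∈A = case u ∈? A of λ where
        (yes i) → i
        (no i)  → contradiction (adj-sym ux) (sep x∈A (∉B x∉W x∈A) (∈B u∈P i) i)
      u≺′v : u ∈ W ⊎ pos u < pos v → u ∈ W ∩ A ⊎ LA.pos u < LA.pos v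
      u≺′v (inj₁ i) = inj₁ (x∈p∩q⁺ (i , u∈A))
      u≺′v (inj₂ lt) with before v∉W lt
      ... | AA _ _ q = inj₂ q
      ... | AB _ v∉A = contradiction v∈A v∉A
      ... | BB _ v∉A _ = contradiction v∈A v∉A
    ... | AA v∈A x∈A v<x | AB _ y∉A   = sep v∈A (∉B v∉W v∈A) (∈B y∈P y∉A) y∉A vy
    ... | AA v∈A x∈A v<x | BB x∉A _ _ = x∉A x∈A
    ... | AB v∈A x∉A | AA x∈A _ _ = x∉A x∈A
    ... | AB v∈A x∉A | AB x∈A _   = x∉A x∈A
    ... | AB v∈A x∉A | BB _ y∉A _ = sep v∈A (∉B v∉W v∈A) (∈B y∈P y∉A) y∉A vy
    ... | BB v∉A x∉A v<x | AA x∈A _ _ = x∉A x∈A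
    ... | BB v∉A x∉A v<x | AB x∈A _   = x∉A x∈A
    ... | BB v∉A x∉A v<x | BB _ y∉A x<y =
      LB.good u∈B v∈B (∉∩ B v∉W) x∈B (∉∩ B x∉W) (∈B y∈P y∉A) (∉∩ B y∉W)
        (u≺′v u≺v) v<x x<y ux vy (trans (sym (χ-B u∈B)) (trans eq (χ-B v∈B)))
      where
      v∈B : v ∈ B
      v∈B = ∈B v∈P v∉A
      x∈B : x ∈ B
      x∈B = ∈B x∈P x∉A
      u∈B : u ∈ B
      u∈B = case u ∈? B of λ where
        (yes i) → i
        (no i)  → [ (λ u∈A → contradiction ux (sep u∈A i x∈B x∉A)) , (λ j → j) ]′ (cov u∈P)
      u≺′v : u ∈ W ⊎ pos u < pos v → u ∈ W ∩ B ⊎ LB.pos u < LB.pos v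
      u≺′v (inj₁ i) = inj₁ (x∈p∩q⁺ (i , u∈B))
      u≺′v (inj₂ lt) with before v∉W lt
      ... | AA _ v∈A _ = contradiction v∈A v∉A
      -- Here `u` comes earlier only as a vertex of `A`; being in `B` as well, it lies in `W`.
      ... | AB u∈A _   = inj₁ (x∈p∩q⁺ (A∩B⊆W (x∈p∩q⁺ (u∈A , u∈B)) , u∈B))
      ... | BB _ _ q   = inj₂ q

    join : Layout P W χ₀
    join = record
      { pos     = pos
      ; bound   = LA.bound + LB.bound
      ; pos<    = λ {x} → pos< {x}
      ; pos-inj = pos-inj
      ; χ       = χ
      ; agree   = agree
      ; good    = good
      }

  elim⇒layout : ∀ {K P W} → W ⊆ P → (χ₀ : Fin n → Fin K) →
    (∀ {x y} → x ∈ W → y ∈ W → χ₀ x ≡ χ₀ y → x ≡ y) → Elim K P W → Layout P W χ₀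
  elim⇒layout W⊆P χ₀ inj (done P⊆W) = record
    { pos     = λ _ → 0
    ; bound   = 0
    ; pos<    = λ i j → contradiction (P⊆W i) j
    ; pos-inj = λ i j → contradiction (P⊆W i) j
    ; χ       = χ₀
    ; agree   = λ _ → refl
    ; good    = λ _ i j → contradiction (P⊆W i) j
    }
  elim⇒layout W⊆P χ₀ inj (add w∈P w∉W ∣W∣<K E) =
    extend (elim⇒layout W′⊆P χ₁ inj₁′ E)
    where open Add W⊆P χ₀ inj w∈P w∉W ∣W∣<K
  elim⇒layout {W = W} W⊆P χ₀ inj (split {A} {B} A⊆P B⊆P cov A∩B⊆W sep EA EB) =
    Split.join W⊆P χ₀ A⊆P B⊆P cov A∩B⊆W sep (restrict A EA) (restrict B EB)
    where
    restrict : ∀ Q → Elim _ Q (W ∩ Q) → Layout Q (W ∩ Q) χ₀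
    restrict Q = elim⇒layout (p∩q⊆q W Q) χ₀ λ i j → inj (p∩q⊆p W Q i) (p∩q⊆p W Q j)

  -- Balls in induced subgraphs.

  neighbours : Subset n → Subset n
  neighbours Q = tabulate λ x → does (Finₚ.any? λ y → y ∈? Q ×-dec adj? y x)

  ∈neighbours⁺ : ∀ {Q x y} → y ∈ Q → Adj y x → x ∈ neighbours Q
  ∈neighbours⁺ {Q} {x} {y} y∈Q yx = lookup⇒[]= x _ (trans (lookup∘tabulate _ x)
    (dec-true (Finₚ.any? λ y → y ∈? Q ×-dec adj? y x) (y , y∈Q , yx)))

  ∈neighbours⁻ : ∀ {Q x} → x ∈ neighbours Q → ∃[ y ] (y ∈ Q × Adj y x)
  ∈neighbours⁻ {Q} {x} i with Finₚ.any? (λ y → y ∈? Q ×-dec adj? y x)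
    | trans (sym (lookup∘tabulate (λ x → does (Finₚ.any? λ y → y ∈? Q ×-dec adj? y x)) x)) ([]=⇒lookup i)
  ... | yes ex | _ = ex

  -- Distance is measured inside `P`, not in the whole graph, so balls change as the recursion
  -- passes to smaller `P`.
  ball : Subset n → Fin n → ℕ → Subset n
  ball P v zero    = ⁅ v ⁆
  ball P v (suc r) = ball P v r ∪ (P ∩ neighbours (ball P v r))

  private
    variable
      P : Subset n
      v x y z : Fin n
      r r′ : ℕ

  ball-suc⁺ : y ∈ ball P v r → x ∈ P → Adj y x → x ∈ ball P v (suc r)
  ball-suc⁺ y∈ x∈P yx = x∈p∪q⁺ (inj₂ (x∈p∩q⁺ (x∈P , ∈neighbours⁺ y∈ yx)))

  ball-suc⁻ : x ∈ ball P v (suc r) →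
    x ∈ ball P v r ⊎ (x ∈ P × ∃[ y ] (y ∈ ball P v r × Adj y x))
  ball-suc⁻ {P = P} {v} {r} i with x∈p∪q⁻ (ball P v r) _ i
  ... | inj₁ j = inj₁ j
  ... | inj₂ j = let x∈P , k = x∈p∩q⁻ P _ j in inj₂ (x∈P , ∈neighbours⁻ k)

  centre∈ball : v ∈ ball P v r
  centre∈ball {v} {r = zero}  = x∈⁅x⁆ v
  centre∈ball {r = suc r} = x∈p∪q⁺ (inj₁ (centre∈ball {r = r}))

  ball⊆ : v ∈ P → ball P v r ⊆ P
  ball⊆ {v} {r = zero}  v∈P i with refl ← x∈⁅y⁆⇒x≡y v i = v∈P
  ball⊆ {P = P} {r = suc r} v∈P i with ball-suc⁻ {P = P} {r = r} i
  ... | inj₁ j = ball⊆ {r = r} v∈P j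
  ... | inj₂ (x∈P , _) = x∈P

  ball-mono : r ≤ r′ → ball P v r ⊆ ball P v r′
  ball-mono {r′ = zero} z≤n i = i
  ball-mono {r} {suc r′} r≤1+r′ i with ℕₚ.m≤n⇒m<n∨m≡n r≤1+r′
  ... | inj₁ (s≤s r≤r′) = x∈p∪q⁺ (inj₁ (ball-mono r≤r′ i))
  ... | inj₂ refl      = i

  ball-trans : y ∈ ball P x r → z ∈ ball P y r′ → z ∈ ball P x (r + r′)
  ball-trans {y} {P} {x} {r} {r′ = zero} i j with refl ← x∈⁅y⁆⇒x≡y y j
    rewrite ℕₚ.+-identityʳ r = i
  ball-trans {y} {P} {x} {r} {r′ = suc r′} i j rewrite ℕₚ.+-suc r r′
    with ball-suc⁻ {P = P} {r = r′} j
  ... | inj₁ k = x∈p∪q⁺ (inj₁ (ball-trans {r = r} i k))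
  ... | inj₂ (z∈P , w , w∈ , wz) = ball-suc⁺ {r = r + r′} (ball-trans {r = r} i w∈) z∈P wz

  ball-sym : x ∈ P → y ∈ ball P x r → x ∈ ball P y r
  ball-sym {x} {r = zero} x∈P i with refl ← x∈⁅y⁆⇒x≡y x i = x∈⁅x⁆ x
  ball-sym {x} {P} {y} {r = suc r} x∈P i with ball-suc⁻ {P = P} {r = r} i
  ... | inj₁ j = x∈p∪q⁺ (inj₁ (ball-sym {r = r} x∈P j))
  ... | inj₂ (y∈P , z , z∈ , zy) = ball-trans {r = 1} {r′ = r}
    (ball-suc⁺ {r = 0} (x∈⁅x⁆ y) (ball⊆ {r = r} x∈P z∈) (adj-sym zy)) (ball-sym {r = r} x∈P z∈)

  -- The sphere of radius ρ + 1 around the centre cuts its interior off from its exterior.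
  record Separation (s : ℕ) (P W : Subset n) : Set where
    field
      centre    : Fin n
      centre∈P  : centre ∈ P
      ρ         : ℕ
    inner : Subset n
    inner = ball P centre ρ
    outer : Subset n
    outer = ball P centre (suc ρ)
    sphere : Subset n
    sphere = outer ─ inner
    field
      small     : ∣ sphere ∣ ≤ s
      many-in   : ∣ sphere ∣ ≤ ∣ W ∩ inner ∣
      many-out  : ∣ sphere ∣ ≤ ∣ W ─ outer ∣
      proper    : ∃[ x ] (x ∈ P × x ∉ outer)

  -- Balanced separators from linear growth.

  module LinearGrowth (C : ℕ) (growth : ∀ {P v r} → v ∈ P → 1 ≤ r → ∣ ball P v r ∣ ≤ C * r)
    (dec : ∀ {A : Set} → Dec A) where

    s k : ℕ
    s = 2 * C
    k = (5 * C) * s + s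

    module NoSeparation {P W} (1≤C : 1 ≤ C) (W⊆P : W ⊆ P) (k≤∣W∣ : k ≤ ∣ W ∣)
      (noSep : ¬ Separation s P W) where

      1≤s : 1 ≤ s
      1≤s = ℕₚ.≤-trans 1≤C (ℕₚ.m≤m+n C _)

      s≤∣W∣ : s ≤ ∣ W ∣
      s≤∣W∣ = ℕₚ.≤-trans (ℕₚ.m≤n+m s ((5 * C) * s)) k≤∣W∣

      -- An empty sphere would separate its interior from the rest of P.
      saturated : v ∈ P → ball P v (suc r) ⊆ ball P v r → P ⊆ ball P v r
      saturated {v} {r} v∈P closed {x} x∈P with x ∈? ball P v r
      ... | yes i = i
      ... | no x∉ = contradiction (record
        { centre = v ; centre∈P = v∈P ; ρ = r
        ; small    = subst (_≤ s) (sym sphere≡0) z≤n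
        ; many-in  = subst (_≤ ∣ W ∩ ball P v r ∣) (sym sphere≡0) z≤n
        ; many-out = subst (_≤ ∣ W ─ ball P v (suc r) ∣) (sym sphere≡0) z≤n
        ; proper   = x , x∈P , x∉ ∘ closed
        }) noSep
        where
        S = ball P v (suc r) ─ ball P v r
        sphere≡0 : ∣ S ∣ ≡ 0
        sphere≡0 = trans (cong ∣_∣ (Empty-unique λ (y , i) →
          x∈p─q⇒x∉q (ball P v (suc r)) _ i (closed (p─q⊆p (ball P v (suc r)) _ i)))) (∣⊥∣≡0 n)

      -- Each step that adds a vertex raises the size by at least one; a step that adds none has
      -- reached all of `P`, by `saturated`.
      ball-large : ∀ r → v ∈ P → suc r ≤ ∣ ball P v r ∣ ⊎ P ⊆ ball P v r
      ball-large {v} zero v∈P = inj₁ (ℕₚ.≤-reflexive (sym (∣⁅x⁆∣≡1 v)))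
      ball-large {v} (suc r) v∈P with ball-large r v∈P | ball P v (suc r) ⊆? ball P v r
      ... | inj₂ all | _          = inj₂ (ball-mono (ℕₚ.n≤1+n r) ∘ all)
      ... | inj₁ _   | yes closed = inj₂ (ball-mono (ℕₚ.n≤1+n r) ∘ saturated {r = r} v∈P closed)
      ... | inj₁ le  | no grows   = inj₁ (ℕₚ.≤-trans (s≤s le) (p⊂q⇒∣p∣<∣q∣
        (ball-mono (ℕₚ.n≤1+n r) , ⊈⇒∃ grows)))

      P⊆ball : v ∈ P → P ⊆ ball P v ∣ P ∣
      P⊆ball v∈P with ball-large ∣ P ∣ v∈P
      ... | inj₂ all = all
      ... | inj₁ le  = contradiction (p⊆q⇒∣p∣≤∣q∣ (ball⊆ {r = ∣ P ∣} v∈P)) (ℕₚ.<⇒≱ le)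

      Heavy : ℕ → Set
      Heavy r = ∃[ v ] (v ∈ P × s ≤ ∣ W ∩ ball P v r ∣)

      heavy? : ∀ r → Dec (Heavy r)
      heavy? r = Finₚ.any? λ v → v ∈? P ×-dec (s ℕₚ.≤? ∣ W ∩ ball P v r ∣)

      -- Radius 0 is light, since a ball then holds one vertex while `s ≥ 2`; descending from a
      -- heavy radius therefore meets a light one.
      first-heavy : ∀ r → Heavy r → ∃[ r ] (¬ Heavy r × Heavy (suc r))
      first-heavy zero (v , v∈P , le) = contradiction
        (ℕₚ.≤-trans le (ℕₚ.≤-trans (∣p∩q∣≤∣q∣ W ⁅ v ⁆) (ℕₚ.≤-reflexive (∣⁅x⁆∣≡1 v))))
        (ℕₚ.<⇒≱ (ℕₚ.*-monoʳ-≤ 2 1≤C))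
      first-heavy (suc r) h with heavy? r
      ... | yes h′ = first-heavy r h′
      ... | no ¬h  = r , ¬h , h

      someHeavy : Heavy ∣ P ∣
      someHeavy = let v , v∈W = 0<∣p∣⇒nonempty W (ℕₚ.≤-trans 1≤s s≤∣W∣) ; v∈P = W⊆P v∈W in
        v , v∈P , ℕₚ.≤-trans s≤∣W∣ (p⊆q⇒∣p∣≤∣q∣ λ i → x∈p∩q⁺ (i , P⊆ball v∈P (W⊆P i)))

      module _ {r h} (h+h≤r : h + h ≤ r) (light : ¬ Heavy r) where

        light′ : x ∈ P → ∣ W ∩ ball P x r ∣ < s
        light′ x∈P = ℕₚ.≰⇒> λ le → light (_ , x∈P , le)

        h≤r : h ≤ r
        h≤r = ℕₚ.≤-trans (ℕₚ.m≤m+n h h) h+h≤r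

        -- If a ball of radius `h` held all of `P`, the ball of radius `r` would contain `W`, which
        -- has at least `s` vertices, and be heavy.
        big : x ∈ P → suc h ≤ ∣ ball P x h ∣
        big {x} x∈P with ball-large h x∈P
        ... | inj₁ le  = le
        ... | inj₂ all = contradiction
          (ℕₚ.≤-trans s≤∣W∣ (p⊆q⇒∣p∣≤∣q∣ λ i → x∈p∩q⁺ (i , ball-mono h≤r (all (W⊆P i)))))
          (ℕₚ.<⇒≱ (light′ x∈P))

        -- A maximal family of points of Q at mutual distance greater than r has
        -- at most m members, as the balls of radius h around them are disjoint
        -- and lie in T; the balls of radius r around them cover Q.
        cover : ∀ m (Q T : Subset n) → Q ⊆ P → (∀ {x} → x ∈ Q → ball P x h ⊆ T) →
          ∣ T ∣ < suc m * suc h → ∣ W ∩ Q ∣ ≤ m * s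
        cover m Q T Q⊆P inT few with nonempty? Q
        ... | no e = ℕₚ.≤-trans (∣p∩q∣≤∣q∣ W Q)
          (subst (_≤ m * s) (sym (trans (cong ∣_∣ (Empty-unique e)) (∣⊥∣≡0 n))) z≤n)
        cover zero Q T Q⊆P inT few | yes (x , x∈Q) = contradiction
          (ℕₚ.≤-trans (big (Q⊆P x∈Q)) (p⊆q⇒∣p∣≤∣q∣ (inT x∈Q)))
          (ℕₚ.<⇒≱ (subst (∣ T ∣ <_) (ℕₚ.*-identityˡ (suc h)) few))
        cover (suc m) Q T Q⊆P inT few | yes (x , x∈Q) = begin
          ∣ W ∩ Q ∣
            ≡⟨ ∣p∩q∣+∣p─q∣≡∣p∣ (W ∩ Q) B ⟨
          ∣ (W ∩ Q) ∩ B ∣ + ∣ (W ∩ Q) ─ B ∣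
            ≤⟨ ℕₚ.+-mono-≤
                 (p⊆q⇒∣p∣≤∣q∣ λ i → x∈p∩q⁺ (p∩q⊆p W Q (p∩q⊆p (W ∩ Q) B i) , p∩q⊆q (W ∩ Q) B i))
                 (p⊆q⇒∣p∣≤∣q∣ λ i → let j = p─q⊆p (W ∩ Q) B i in x∈p∩q⁺
                   (p∩q⊆p W Q j , x∈p∧x∉q⇒x∈p─q (p∩q⊆q W Q j) (x∈p─q⇒x∉q (W ∩ Q) B i))) ⟩
          ∣ W ∩ B ∣ + ∣ W ∩ (Q ─ B) ∣
            ≤⟨ ℕₚ.+-mono-≤ (ℕₚ.<⇒≤ (light′ x∈P)) (cover m (Q ─ B) (T ─ D)
                 (Q⊆P ∘ p─q⊆p Q B) inT′ few′) ⟩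
          s + m * s ∎
          where
          open ℕₚ.≤-Reasoning
          x∈P = Q⊆P x∈Q
          B = ball P x r
          D = ball P x h
          -- A common point of the two balls of radius `h` would put `y` within `h + h ≤ r` of `x`,
          -- hence in `B`.
          inT′ : y ∈ Q ─ B → ball P y h ⊆ T ─ D
          inT′ y∈ {z} z∈ = x∈p∧x∉q⇒x∈p─q (inT (p─q⊆p Q B y∈) z∈) λ z∈D →
            x∈p─q⇒x∉q Q B y∈ (ball-mono h+h≤r (ball-trans {r = h} {r′ = h} z∈D
              (ball-sym {r = h} (Q⊆P (p─q⊆p Q B y∈)) z∈)))
          few′ : ∣ T ─ D ∣ < suc m * suc h
          few′ = ℕₚ.+-cancelˡ-< (suc h) _ _ (ℕₚ.≤-<-trans (ℕₚ.≤-trans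
            (ℕₚ.+-monoˡ-≤ ∣ T ─ D ∣ (ℕₚ.≤-trans (big x∈P)
              (p⊆q⇒∣p∣≤∣q∣ λ i → x∈p∩q⁺ (inT x∈Q i , i))))
            (ℕₚ.≤-reflexive (∣p∩q∣+∣p─q∣≡∣p∣ T D))) few)

      module _ {r} (light : ¬ Heavy r) (v∈P : v ∈ P) (heavy : s ≤ ∣ W ∩ ball P v (suc r) ∣) where

        R h : ℕ
        R = suc r
        -- Small enough that `h + h ≤ r`, which makes the packed balls disjoint; large enough that
        -- `R ≤ 2 * suc h`, which bounds their number.
        h = ⌊ r /2⌋

        h+h≤r : h + h ≤ r
        h+h≤r = ℕₚ.≤-trans (ℕₚ.+-monoʳ-≤ h (ℕₚ.⌊n/2⌋≤⌈n/2⌉ r)) (ℕₚ.≤-reflexive (ℕₚ.⌊n/2⌋+⌈n/2⌉≡n r))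

        R≤2+h+h : R ≤ 2 * suc h
        R≤2+h+h = begin
          suc r               ≡⟨ cong suc (ℕₚ.⌊n/2⌋+⌈n/2⌉≡n r) ⟨
          suc (h + ⌊ suc r /2⌋) ≤⟨ s≤s (ℕₚ.+-monoʳ-≤ h (ℕₚ.⌊n/2⌋-mono (ℕₚ.n≤1+n (suc r)))) ⟩
          suc (h + suc h)     ≡⟨ cong (suc h +_) (ℕₚ.+-identityʳ (suc h)) ⟨
          2 * suc h           ∎
          where open ℕₚ.≤-Reasoning

        -- Balls of radius `h` centred within `2 * R` of `v` stay within `2 * R + h`, which is at
        -- most `5 * suc h` because `R ≤ 2 * suc h`. This is where the factor 5 in `k` comes from.
        few : ∣ ball P v (2 * R + h) ∣ < suc (5 * C) * suc h
        few = begin-strict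
          ∣ ball P v (2 * R + h) ∣ ≤⟨ growth v∈P (s≤s z≤n) ⟩
          C * (2 * R + h)          ≤⟨ ℕₚ.*-monoʳ-≤ C (ℕₚ.+-mono-≤ (ℕₚ.*-monoʳ-≤ 2 R≤2+h+h) (ℕₚ.n≤1+n h)) ⟩
          C * (2 * (2 * suc h) + suc h)
            ≡⟨ solve 2 (λ c x → c :* (con 2 :* (con 2 :* x) :+ x) := con 5 :* c :* x) refl C (suc h) ⟩
          5 * C * suc h            <⟨ s≤s (ℕₚ.m≤n+m _ h) ⟩
          suc (5 * C) * suc h ∎
          where
          open ℕₚ.≤-Reasoning
          open ℕ-Solver.+-*-Solver

        few-in : ∣ W ∩ ball P v (2 * R) ∣ ≤ (5 * C) * s
        few-in = cover h+h≤r light (5 * C) (ball P v (2 * R)) (ball P v (2 * R + h))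
          (ball⊆ {r = 2 * R} v∈P) (λ i → ball-trans {r = 2 * R} {r′ = h} i) few

        many-out : s ≤ ∣ W ─ ball P v (2 * R) ∣
        many-out = ℕₚ.+-cancelˡ-≤ ((5 * C) * s) _ _ (begin
          (5 * C) * s + s  ≤⟨ k≤∣W∣ ⟩
          ∣ W ∣            ≡⟨ ∣p∩q∣+∣p─q∣≡∣p∣ W B ⟨
          ∣ W ∩ B ∣ + ∣ W ─ B ∣  ≤⟨ ℕₚ.+-monoˡ-≤ _ few-in ⟩
          (5 * C) * s + ∣ W ─ B ∣ ∎)
          where
          open ℕₚ.≤-Reasoning
          B = ball P v (2 * R)

        -- A thinner sphere would be a separation: the heavy ball of radius `R` lies inside it, and
        -- `many-out` leaves `s` vertices of `W` beyond it.
        thick : ∀ {ρ} → R ≤ ρ → suc ρ ≤ 2 * R → suc s ≤ ∣ ball P v (suc ρ) ─ ball P v ρ ∣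
        thick {ρ} R≤ρ ρ<2R = ℕₚ.≰⇒> λ small → noSep (record
          { centre = v ; centre∈P = v∈P ; ρ = ρ ; small = small
          ; many-in  = ℕₚ.≤-trans small (ℕₚ.≤-trans heavy
              (p⊆q⇒∣p∣≤∣q∣ λ i → x∈p∩q⁺
                (p∩q⊆p W _ i , ball-mono R≤ρ (p∩q⊆q W (ball P v R) i))))
          ; many-out = ℕₚ.≤-trans small many-out′
          ; proper   = let x , i = 0<∣p∣⇒nonempty (W ─ ball P v (suc ρ)) (ℕₚ.≤-trans 1≤s many-out′) in
              x , W⊆P (p─q⊆p W _ i) , x∈p─q⇒x∉q W _ i
          })
          where
          many-out′ : s ≤ ∣ W ─ ball P v (suc ρ) ∣
          many-out′ = ℕₚ.≤-trans many-out (p⊆q⇒∣p∣≤∣q∣ λ i → x∈p∧x∉q⇒x∈p─q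
            (p─q⊆p W (ball P v (2 * R)) i)
            (x∈p─q⇒x∉q W (ball P v (2 * R)) i ∘ ball-mono ρ<2R))

        layers : ∀ j → j ≤ R → j * suc s ≤ ∣ ball P v (R + j) ∣
        layers zero    _    = z≤n
        layers (suc j) j<R rewrite ℕₚ.+-suc r j = begin
          suc s + j * suc s
            ≤⟨ ℕₚ.+-mono-≤ (thick (ℕₚ.m≤m+n R j)
                 (ℕₚ.≤-trans (ℕₚ.≤-reflexive (sym (ℕₚ.+-suc R j)))
                   (ℕₚ.+-monoʳ-≤ R (ℕₚ.≤-trans j<R (ℕₚ.m≤m+n R 0)))))
                 (layers j (ℕₚ.<⇒≤ j<R)) ⟩
          ∣ ball P v (suc (R + j)) ─ ball P v (R + j) ∣ + ∣ ball P v (R + j) ∣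
            ≤⟨ disjoint⇒∣p∣+∣q∣≤∣t∣ (p─q⊆p (ball P v (suc (R + j))) _)
                 (ball-mono (ℕₚ.n≤1+n (R + j))) (x∈p─q⇒x∉q (ball P v (suc (R + j))) _) ⟩
          ∣ ball P v (suc (R + j)) ∣ ∎
          where open ℕₚ.≤-Reasoning

        -- The `R` disjoint spheres between radii `R` and `2 * R` hold at least `R * (2 * C + 1)`
        -- vertices, whereas growth allows only `2 * C * R`.
        absurd : ⊥
        absurd = ℕₚ.<⇒≱
          (begin-strict
            C * (R + R)   ≡⟨ solve 2 (λ c x → c :* (x :+ x) := x :* (con 2 :* c)) refl C R ⟩
            R * s         <⟨ ℕₚ.*-monoʳ-< R (ℕₚ.n<1+n s) ⟩
            R * suc s     ∎)
          (ℕₚ.≤-trans (layers R ℕₚ.≤-refl) (growth v∈P (s≤s z≤n)))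
          where
          open ℕₚ.≤-Reasoning
          open ℕ-Solver.+-*-Solver

      impossible : ⊥
      impossible = let r , light , v , v∈P , heavy = first-heavy ∣ P ∣ someHeavy in
        absurd {r = r} light v∈P heavy

    separate : ∀ {P W} → 1 ≤ C → W ⊆ P → k ≤ ∣ W ∣ → Separation s P W
    separate {P} {W} 1≤C W⊆P k≤∣W∣ with dec {Separation s P W}
    ... | yes sep   = sep
    ... | no  noSep = ⊥-elim (NoSeparation.impossible 1≤C W⊆P k≤∣W∣ noSep)

    -- Tree-decompositions from separators.

    K : ℕ
    K = k + s

    -- The vertices of `W′` outside `W` enter the bag one at a time; before each of them the bag is
    -- a proper subset of `W′`, hence smaller than `K`. The fuel `m` bounds how many are left.
    add-all : ∀ m {P W W′} → W ⊆ W′ → W′ ⊆ P → ∣ W′ ∣ ≤ K → ∣ W′ ∣ ≤ ∣ W ∣ + m →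
      Elim K P W′ → Elim K P W
    add-all m {P} {W} {W′} W⊆W′ W′⊆P ∣W′∣≤K le E with W′ ⊆? W
    ... | yes W′⊆W = subst (Elim K P) (⊆-antisym W′⊆W W⊆W′) E
    add-all zero {W = W} W⊆W′ W′⊆P ∣W′∣≤K le E | no W′⊈W = contradiction
      (ℕₚ.≤-trans le (ℕₚ.≤-reflexive (ℕₚ.+-identityʳ ∣ W ∣)))
      (ℕₚ.<⇒≱ (p⊂q⇒∣p∣<∣q∣ (W⊆W′ , ⊈⇒∃ W′⊈W)))
    add-all (suc m) {P} {W} {W′} W⊆W′ W′⊆P ∣W′∣≤K le E | no W′⊈W =
      add (W′⊆P w∈W′) w∉W (ℕₚ.<-≤-trans (p⊂q⇒∣p∣<∣q∣ (W⊆W′ , w , w∈W′ , w∉W)) ∣W′∣≤K)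
        (add-all m (λ i → [ W⊆W′ , (λ j → subst (_∈ W′) (sym (x∈⁅y⁆⇒x≡y w j)) w∈W′) ]′ (x∈p∪q⁻ W ⁅ w ⁆ i))
          W′⊆P ∣W′∣≤K le′ E)
      where
      w = proj₁ (⊈⇒∃ W′⊈W)
      w∈W′ = proj₁ (proj₂ (⊈⇒∃ W′⊈W))
      w∉W = proj₂ (proj₂ (⊈⇒∃ W′⊈W))
      le′ : ∣ W′ ∣ ≤ ∣ W ∪ ⁅ w ⁆ ∣ + m
      le′ = ℕₚ.≤-trans le (ℕₚ.≤-trans (ℕₚ.≤-reflexive (ℕₚ.+-suc ∣ W ∣ m))
        (ℕₚ.+-monoˡ-≤ m (p⊂q⇒∣p∣<∣q∣ (p⊆p∪q ⁅ w ⁆ , w , x∈p∪q⁺ (inj₂ (x∈⁅x⁆ w)) , w∉W))))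

    -- An exchange: passing to the side `A` gains at most `S` and loses `W ─ I`, which is at least
    -- as large.
    ∣W∩A∣≤k : ∀ (W S I A : Subset n) → ∣ W ∣ ≤ k → (∀ {x} → x ∈ W → x ∈ A → x ∈ I) →
      ∣ S ∣ ≤ ∣ W ─ I ∣ → ∣ (W ∪ S) ∩ A ∣ ≤ k
    ∣W∩A∣≤k W S I A ∣W∣≤k A⊆ le = begin
      ∣ (W ∪ S) ∩ A ∣  ≤⟨ p⊆q⇒∣p∣≤∣q∣ lies ⟩
      ∣ (W ∩ I) ∪ S ∣  ≤⟨ ∣p∪q∣≤∣p∣+∣q∣ (W ∩ I) S ⟩
      ∣ W ∩ I ∣ + ∣ S ∣  ≤⟨ ℕₚ.+-monoʳ-≤ ∣ W ∩ I ∣ le ⟩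
      ∣ W ∩ I ∣ + ∣ W ─ I ∣  ≡⟨ ∣p∩q∣+∣p─q∣≡∣p∣ W I ⟩
      ∣ W ∣  ≤⟨ ∣W∣≤k ⟩
      k ∎
      where
      open ℕₚ.≤-Reasoning
      lies : (W ∪ S) ∩ A ⊆ (W ∩ I) ∪ S
      lies i with x∈p∪q⁻ W S (p∩q⊆p (W ∪ S) A i)
      ... | inj₂ x∈S = x∈p∪q⁺ (inj₂ x∈S)
      ... | inj₁ x∈W = x∈p∪q⁺ (inj₁ (x∈p∩q⁺ (x∈W , A⊆ x∈W (p∩q⊆q (W ∪ S) A i))))

    -- Induction on `∣ P ∣ + ∣ P ─ W ∣`. Adding a vertex to `W` shrinks the second term. Splitting
    -- shrinks the first, since one side misses the vertex given by `proper` and the other misses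
    -- the centre, and it does not increase the second.
    eliminate : 1 ≤ C → ∀ m {P W} → W ⊆ P → ∣ W ∣ ≤ k → ∣ P ∣ + ∣ P ─ W ∣ < m → Elim K P W
    eliminate 1≤C (suc m) {P} {W} W⊆P ∣W∣≤k (s≤s fuel) with P ⊆? W | ∣ W ∣ ℕₚ.<? k
    ... | yes P⊆W | _ = done P⊆W
    ... | no P⊈W | yes ∣W∣<k = add w∈P w∉W (ℕₚ.<-≤-trans ∣W∣<k (ℕₚ.m≤m+n k s))
        (eliminate 1≤C m
          (λ i → [ W⊆P , (λ j → subst (_∈ P) (sym (x∈⁅y⁆⇒x≡y w j)) w∈P) ]′ (x∈p∪q⁻ W ⁅ w ⁆ i))
          (ℕₚ.≤-trans (∣p∪q∣≤∣p∣+∣q∣ W ⁅ w ⁆)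
            (subst (λ t → ∣ W ∣ + t ≤ k) (sym (∣⁅x⁆∣≡1 w)) (subst (_≤ k) (ℕₚ.+-comm 1 ∣ W ∣) ∣W∣<k)))
          (ℕₚ.<-≤-trans (ℕₚ.+-monoʳ-< ∣ P ∣ (p⊂q⇒∣p∣<∣q∣
            ( (λ i → x∈p∧x∉q⇒x∈p─q (p─q⊆p P _ i) (x∈p─q⇒x∉q P (W ∪ ⁅ w ⁆) i ∘ p⊆p∪q ⁅ w ⁆))
            , w , x∈p∧x∉q⇒x∈p─q w∈P w∉W
            , λ i → x∈p─q⇒x∉q P (W ∪ ⁅ w ⁆) i (x∈p∪q⁺ (inj₂ (x∈⁅x⁆ w)))))) fuel))
      where
      w = proj₁ (⊈⇒∃ P⊈W)
      w∈P = proj₁ (proj₂ (⊈⇒∃ P⊈W))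
      w∉W = proj₂ (proj₂ (⊈⇒∃ P⊈W))
    -- The bag is full. It first takes in the sphere, reaching size at most `K = k + s`, and `P` is
    -- then cut along the sphere.
    ... | no P⊈W | no ∣W∣≮k = add-all s (p⊆p∪q S) W′⊆P ∣W′∣≤K ∣W′∣≤∣W∣+s
        (split outer⊆P (p─q⊆p P inner) cov A∩B⊆W′ cut
          (eliminate 1≤C m (p∩q⊆q W′ outer)
            (∣W∩A∣≤k W S outer outer ∣W∣≤k (λ _ i → i) many-out)
            (smaller outer⊆P (proj₁ (proj₂ proper)) (proj₂ (proj₂ proper))))
          (eliminate 1≤C m (p∩q⊆q W′ (P ─ inner))
            (∣W∩A∣≤k W S (W ─ inner) (P ─ inner) ∣W∣≤k
              (λ i j → x∈p∧x∉q⇒x∈p─q i (x∈p─q⇒x∉q P inner j)) many-in′)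
            (smaller (p─q⊆p P inner) centre∈P
              λ i → x∈p─q⇒x∉q P inner i (centre∈ball {r = ρ}))))
      where
      open Separation (separate 1≤C W⊆P (ℕₚ.≮⇒≥ ∣W∣≮k)) renaming (sphere to S)
      W′ = W ∪ S

      outer⊆P : outer ⊆ P
      outer⊆P = ball⊆ {r = suc ρ} centre∈P

      W′⊆P : W′ ⊆ P
      W′⊆P i = [ W⊆P , outer⊆P ∘ p─q⊆p outer inner ]′ (x∈p∪q⁻ W S i)

      ∣W′∣≤∣W∣+s : ∣ W′ ∣ ≤ ∣ W ∣ + s
      ∣W′∣≤∣W∣+s = ℕₚ.≤-trans (∣p∪q∣≤∣p∣+∣q∣ W S) (ℕₚ.+-monoʳ-≤ ∣ W ∣ small)

      ∣W′∣≤K : ∣ W′ ∣ ≤ K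
      ∣W′∣≤K = ℕₚ.≤-trans ∣W′∣≤∣W∣+s (ℕₚ.+-monoˡ-≤ s ∣W∣≤k)

      cov : ∀ {x} → x ∈ P → x ∈ outer ⊎ x ∈ P ─ inner
      cov {x} x∈P with x ∈? inner
      ... | yes i = inj₁ (p⊆p∪q _ i)
      ... | no i  = inj₂ (x∈p∧x∉q⇒x∈p─q x∈P i)

      A∩B⊆W′ : outer ∩ (P ─ inner) ⊆ W′
      A∩B⊆W′ i = x∈p∪q⁺ (inj₂ (x∈p∧x∉q⇒x∈p─q (p∩q⊆p outer _ i)
        (x∈p─q⇒x∉q P inner (p∩q⊆q outer (P ─ inner) i))))

      cut : ∀ {x y} → x ∈ outer → x ∉ P ─ inner → y ∈ P ─ inner → y ∉ outer → ¬ Adj x y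
      cut {x} x∈outer x∉B y∈B y∉outer xy with x ∈? inner
      ... | yes i = y∉outer (ball-suc⁺ {r = ρ} i (p─q⊆p P inner y∈B) xy)
      ... | no i  = x∉B (x∈p∧x∉q⇒x∈p─q (outer⊆P x∈outer) i)

      many-in′ : ∣ S ∣ ≤ ∣ W ─ (W ─ inner) ∣
      many-in′ = ℕₚ.≤-trans many-in (p⊆q⇒∣p∣≤∣q∣ λ i → x∈p∧x∉q⇒x∈p─q (p∩q⊆p W inner i)
        λ j → x∈p─q⇒x∉q W inner j (p∩q⊆q W inner i))

      smaller : ∀ {A x} → A ⊆ P → x ∈ P → x ∉ A → ∣ A ∣ + ∣ A ─ (W′ ∩ A) ∣ < m
      smaller {A} A⊆P x∈P x∉A = ℕₚ.<-≤-trans (ℕₚ.+-mono-<-≤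
        (p⊂q⇒∣p∣<∣q∣ (A⊆P , _ , x∈P , x∉A))
        (p⊆q⇒∣p∣≤∣q∣ λ i → let y∈A = p─q⊆p A _ i in x∈p∧x∉q⇒x∈p─q (A⊆P y∈A)
          λ y∈W → x∈p─q⇒x∉q A (W′ ∩ A) i (x∈p∩q⁺ (p⊆p∪q S y∈W , y∈A)))) fuel

-- Excluded middle and Tukey's lemma.

module Classical (em : ExcludedMiddle ℓ) where

  abstract
    ⟦_⟧ : Set ℓ → Bool
    ⟦ P ⟧ = does (em {P})

    ⟦⟧⁺ : ∀ {P} → P → ⟦ P ⟧ ≡ true
    ⟦⟧⁺ = dec-true em

    ⟦⟧⁻ : ∀ {P} → ⟦ P ⟧ ≡ true → P
    ⟦⟧⁻ {P} eq with em {P}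
    ... | yes p = p

-- Sets are Boolean-valued predicates, which keeps the universe level, and hence
-- the reach of excluded middle, at ℓ.
module Sets {A : Set ℓ} where

  infix 4 _∈ᵇ_ _⊆ᵇ_

  _∈ᵇ_ : A → (A → Bool) → Set
  x ∈ᵇ S = S x ≡ true

  _⊆ᵇ_ : (A → Bool) → (A → Bool) → Set ℓ
  S ⊆ᵇ T = ∀ x → x ∈ᵇ S → x ∈ᵇ T

  ⊆ᵇ-antisym : Extensionality ℓ 0ℓ → ∀ {S T} → S ⊆ᵇ T → T ⊆ᵇ S → S ≡ T
  ⊆ᵇ-antisym ext {S} {T} S⊆T T⊆S = ext λ x → lem (S⊆T x) (T⊆S x)
    where
    lem : ∀ {b c} → (b ≡ true → c ≡ true) → (c ≡ true → b ≡ true) → b ≡ c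
    lem {true}          f g = sym (f refl)
    lem {false} {true}  f g = g refl
    lem {false} {false} f g = refl

-- Tukey's lemma for the property "every finite list of members satisfies Con".
-- The tower of sets obtained from ∅ by adding single elements and taking
-- unions is a chain, so its union is a maximal member.
module Tukey (em : ExcludedMiddle ℓ) (ext : Extensionality ℓ 0ℓ) {A : Set ℓ}
  (Con : List A → Set ℓ) (Con-[] : Con [])
  (Con-anti : ∀ {xs ys} → xs ⊆ₗ ys → Con ys → Con xs) where

  open Classical em
  open Sets {A = A}

  Consistent : (A → Bool) → Set ℓ
  Consistent S = ∀ xs → All (_∈ᵇ S) xs → Con xs

  Addable : (A → Bool) → A → Set ℓ
  Addable S x = ∀ xs → All (_∈ᵇ S) xs → Con (x ∷ xs)

  Extensible : (A → Bool) → Set ℓ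
  Extensible S = ∃[ x ] (¬ (x ∈ᵇ S) × Addable S x)

  insert : A → (A → Bool) → (A → Bool)
  insert x S y = ⟦ y ∈ᵇ S ⊎ y ≡ x ⟧

  -- Excluded middle picks the element to add. That at most one is added is what makes the tower a
  -- chain.
  step : (A → Bool) → (A → Bool)
  step S with em {Extensible S}
  ... | yes (x , _) = insert x S
  ... | no _        = S

  ⋃ᵇ : ((A → Bool) → Bool) → (A → Bool)
  ⋃ᵇ D x = ⟦ ∃[ S ] (D S ≡ true × x ∈ᵇ S) ⟧

  data Tower : (A → Bool) → Set ℓ where
    next : ∀ {S} → Tower S → Tower (step S)
    -- The empty family `D` gives the empty set, with which the tower starts.
    sup  : (D : (A → Bool) → Bool) → (∀ S → D S ≡ true → Tower S) → Tower (⋃ᵇ D)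

  private
    variable
      S T : A → Bool

  _∈ᵇ?_ : ∀ x S → Dec (x ∈ᵇ S)
  x ∈ᵇ? S = S x Boolₚ.≟ true

  ⊈ᵇ⇒∃ : ¬ (S ⊆ᵇ T) → ∃[ x ] (x ∈ᵇ S × ¬ (x ∈ᵇ T))
  ⊈ᵇ⇒∃ {S} {T} S⊈T = decidable-stable em λ none → S⊈T λ x x∈S →
    decidable-stable (x ∈ᵇ? T) λ x∉T → none (x , x∈S , x∉T)

  ⊆step : S ⊆ᵇ step S
  ⊆step {S} y y∈S with em {Extensible S}
  ... | yes _ = ⟦⟧⁺ (inj₁ y∈S)
  ... | no _  = y∈S

  step-new : ∀ {x y} → x ∈ᵇ step S → ¬ (x ∈ᵇ S) → y ∈ᵇ step S → ¬ (y ∈ᵇ S) → x ≡ y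
  step-new {S} x∈ x∉ y∈ y∉ with em {Extensible S}
  ... | no _ = contradiction x∈ x∉
  ... | yes _ with ⟦⟧⁻ x∈ | ⟦⟧⁻ y∈
  ...   | inj₁ x∈S | _        = contradiction x∈S x∉
  ...   | _        | inj₁ y∈S = contradiction y∈S y∉
  ...   | inj₂ p   | inj₂ q   = trans p (sym q)

  Comparable : (A → Bool) → Set ℓ
  Comparable S = ∀ {T} → Tower T → T ⊆ᵇ S ⊎ S ⊆ᵇ T

  -- Induction on the tower. In the critical case `T ⊆ᵇ S ⊆ᵇ step T` with some `z` in `S` outside
  -- `T`, this `z` is the one new element of `step T`, so `step T ⊆ᵇ S`.
  below-or-above : Comparable S → Tower T → T ⊆ᵇ S ⊎ step S ⊆ᵇ T
  below-or-above {S} cmp (next {T} t) with below-or-above cmp t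
  ... | inj₂ above = inj₂ λ x → ⊆step x ∘ above x
  ... | inj₁ T⊆S with em {S ⊆ᵇ T}
  ...   | yes S⊆T rewrite ⊆ᵇ-antisym ext S⊆T T⊆S = inj₂ λ _ x∈ → x∈
  ...   | no S⊈T with ⊈ᵇ⇒∃ S⊈T | cmp (next t)
  ...     | _ | inj₁ below = inj₁ below
  ...     | z , z∈S , z∉T | inj₂ S⊆T⁺ = inj₁ below
    where
    below : step T ⊆ᵇ S
    below y y∈ with y ∈ᵇ? T
    ... | yes y∈T = T⊆S y y∈T
    ... | no y∉T  = subst (_∈ᵇ S) (step-new (S⊆T⁺ z z∈S) z∉T y∈ y∉T) z∈S
  below-or-above {S} cmp (sup D towers) with em {∀ T → D T ≡ true → T ⊆ᵇ S}
  ... | yes below = inj₁ λ x x∈ → let T , T∈D , x∈T = ⟦⟧⁻ x∈ in below T T∈D x x∈T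
  ... | no ¬below = inj₂ λ x x∈ → decidable-stable (x ∈ᵇ? ⋃ᵇ D) λ x∉ →
    ¬below λ T T∈D → case below-or-above cmp (towers T T∈D) of λ where
      (inj₁ T⊆S)   → T⊆S
      (inj₂ above) → contradiction (⟦⟧⁺ (T , T∈D , above x x∈)) x∉

  comparable : Tower S → Comparable S
  comparable (next s) t with below-or-above (comparable s) t
  ... | inj₁ T⊆S   = inj₁ λ x → ⊆step x ∘ T⊆S x
  ... | inj₂ above = inj₂ above
  comparable (sup D towers) {T} t with em {∀ S → D S ≡ true → S ⊆ᵇ T}
  ... | yes below = inj₂ λ x x∈ → let S , S∈D , x∈S = ⟦⟧⁻ x∈ in below S S∈D x x∈S
  ... | no ¬below = inj₁ λ x x∈T → decidable-stable (x ∈ᵇ? ⋃ᵇ D) λ x∉ →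
    ¬below λ S S∈D → case comparable (towers S S∈D) t of λ where
      (inj₁ T⊆S) → contradiction (⟦⟧⁺ (S , S∈D , T⊆S x x∈T)) x∉
      (inj₂ S⊆T) → S⊆T

  -- After a step, the new element is stripped from the list and its addability applies. For a
  -- union, a finite list lies in a single member of the family, because the tower is a chain.
  tower⇒consistent : Tower S → Consistent S
  tower⇒consistent (next {S} s) xs all with em {Extensible S}
  ... | no _ = tower⇒consistent s xs all
  ... | yes (x , x∉ , addable) =
    let ys , ys⊆S , xs⊆ = strip xs all in Con-anti xs⊆ (addable ys ys⊆S)
    where
    strip : ∀ xs → All (_∈ᵇ insert x S) xs → ∃[ ys ] (All (_∈ᵇ S) ys × xs ⊆ₗ (x ∷ ys))
    strip []       []         = [] , [] , λ ()
    strip (z ∷ xs) (z∈ ∷ xs∈) with strip xs xs∈ | ⟦⟧⁻ z∈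
    ... | ys , ys⊆S , xs⊆ | inj₁ z∈S  = z ∷ ys , z∈S ∷ ys⊆S , λ where
      (here refl) → there (here refl)
      (there i)   → case xs⊆ i of λ where
        (here eq) → here eq
        (there j) → there (there j)
    ... | ys , ys⊆S , xs⊆ | inj₂ refl = ys , ys⊆S , λ where
      (here refl) → here refl
      (there i)   → xs⊆ i
  tower⇒consistent (sup D towers) [] [] = Con-[]
  tower⇒consistent (sup D towers) (x ∷ xs) (x∈ ∷ xs∈) =
    let S , S∈D , all = collect x∈ xs∈ in tower⇒consistent (towers S S∈D) (x ∷ xs) all
    where
    collect : ∀ {x xs} → x ∈ᵇ ⋃ᵇ D → All (_∈ᵇ ⋃ᵇ D) xs →
      ∃[ S ] (D S ≡ true × All (_∈ᵇ S) (x ∷ xs))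
    collect x∈ [] = let S , S∈D , x∈S = ⟦⟧⁻ x∈ in S , S∈D , x∈S ∷ []
    collect {x} x∈ (y∈ ∷ ys∈) with ⟦⟧⁻ x∈ | collect y∈ ys∈
    ... | S , S∈D , x∈S | T , T∈D , all with comparable (towers S S∈D) (towers T T∈D)
    ...   | inj₁ T⊆S = S , S∈D , x∈S ∷ All.map (T⊆S _) all
    ...   | inj₂ S⊆T = T , T∈D , S⊆T x x∈S ∷ all

  -- The union `M` of the whole tower is itself in the tower, and so is `step M`; hence
  -- `step M ⊆ᵇ M`, and nothing can be added to `M`.
  maximal : ∃[ M ] (Consistent M × (∀ {x} → Addable M x → x ∈ᵇ M))
  maximal = M , tower⇒consistent M-tower , λ {x} addable → decidable-stable (x ∈ᵇ? M) λ x∉ →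
    extend (x , x∉ , addable)
    where
    M : A → Bool
    M = ⋃ᵇ λ S → ⟦ Tower S ⟧
    M-tower : Tower M
    M-tower = sup _ λ _ → ⟦⟧⁻
    extend : ¬ Extensible M
    extend ex with em {Extensible M} | (λ x x∈ → ⟦⟧⁺ {P = ∃[ S ] (⟦ Tower S ⟧ ≡ true × x ∈ᵇ S)} (step M , ⟦⟧⁺ (next M-tower) , x∈))
    ... | no ¬ex          | _ = ¬ex ex
    ... | yes (x , x∉ , _) | step⊆ = x∉ (step⊆ x (⟦⟧⁺ (inj₂ refl)))

-- Compactness.

does-true⁻ : ∀ {A : Set ℓ} (a? : Dec A) → does a? ≡ true → A
does-true⁻ (yes a) _ = a

does-not⁻ : ∀ {A : Set ℓ} (a? : Dec A) → not (does a?) ≡ true → ¬ A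
does-not⁻ (no ¬a) _ = ¬a

module _ (G : Graph ℓ) where
  open Graph G

  -- `pos` and `χ` are total, with arbitrary values off `F`, so that layouts for different `F` can
  -- be compared at the same vertices.
  record FiniteLayout (k : ℕ) (F : List Vertex) : Set ℓ where
    field
      pos     : Vertex → ℕ
      pos-inj : ∀ {u v} → u ∈ₗ F → v ∈ₗ F → pos u ≡ pos v → u ≡ v
      χ       : Vertex → Fin k
      good    : ∀ {u v x y} → u ∈ₗ F → v ∈ₗ F → x ∈ₗ F → y ∈ₗ F →
                pos u < pos v → pos v < pos x → pos x < pos y →
                Adj u x → Adj v y → χ u ≢ χ v

  module Compactness (em : ExcludedMiddle ℓ) (ext : Extensionality ℓ 0ℓ) {k}
    (layout : ∀ F → FiniteLayout k F) where

    module L F = FiniteLayout (layout F)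
    open Sets {A = List Vertex → Bool}

    -- The intersection of the sets in `Xs` has to be cofinal among the finite vertex sets, not
    -- merely nonempty; this puts every cone of supersets of a given `vs` into the ultrafilter.
    Con : List (List Vertex → Bool) → Set ℓ
    Con Xs = ∀ vs → ∃[ F ] (vs ⊆ₗ F × All (λ X → X F ≡ true) Xs)

    Con-[] : Con []
    Con-[] vs = vs , (λ i → i) , []

    Con-anti : ∀ {Xs Ys} → Xs ⊆ₗ Ys → Con Ys → Con Xs
    Con-anti Xs⊆Ys con vs = let F , vs⊆F , all = con vs in F , (λ i → vs⊆F i) , Allₚ.anti-mono Xs⊆Ys all

    -- A maximal consistent family is an ultrafilter on the finite sets of
    -- vertices that contains, for every vertex v, the set of all F containing v.
    open Tukey em ext {A = List Vertex → Bool} Con Con-[] Con-anti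
      using (maximal; _∈ᵇ?_)

    U : (List Vertex → Bool) → Bool
    U = proj₁ maximal

    -- The transfer principle: finitely many facts that hold for `U`-most `F` hold together at one
    -- `F` containing any prescribed vertices.
    realise : ∀ {Xs} → All (_∈ᵇ U) Xs → Con Xs
    realise = proj₁ (proj₂ maximal) _

    -- By maximality the complement only has to be addable. If `ys` and `vs` witness that it is not,
    -- every `F` above `vs` in all of `ys` lies in `X`; then `X` is addable, so it lies in `U`.
    complement : ∀ {X} → ¬ X ∈ᵇ U → (not ∘ X) ∈ᵇ U
    complement {X} X∉U = proj₂ (proj₂ maximal) λ ys ys⊆U vs → decidable-stable em λ none →
      X∉U (proj₂ (proj₂ maximal) λ xs xs⊆U ws →
        let F , ⊆F , all = realise (Allₚ.++⁺ xs⊆U ys⊆U) (ws ++ vs)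
        in F , (λ i → ⊆F (∈-++⁺ˡ i)) , member none F (λ i → ⊆F (∈-++⁺ʳ ws i)) (Allₚ.++⁻ʳ xs all) ∷ Allₚ.++⁻ˡ xs all)
      where
      member : ∀ {vs ys} → ¬ (∃[ F ] (vs ⊆ₗ F × All (λ X → X F ≡ true) ((not ∘ X) ∷ ys))) →
        ∀ F → vs ⊆ₗ F → All (λ X → X F ≡ true) ys → X F ≡ true
      member none F vs⊆F all with X F in eq
      ... | true  = refl
      ... | false = ⊥-elim (none (F , (λ i → vs⊆F i) , cong not eq ∷ all))

    before : Vertex → Vertex → List Vertex → Bool
    before u v F = does (L.pos F u ℕₚ.≤? L.pos F v)

    colour : Vertex → Fin k → List Vertex → Bool
    colour v i F = does (L.χ F v Finₚ.≟ i)

    infix 4 _≼_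
    -- The ultralimit of the finite orders.
    _≼_ : Vertex → Vertex → Set ℓ
    u ≼ v = Lift ℓ (before u v ∈ᵇ U)

    before⁻ : ∀ {u v} F → before u v F ≡ true → L.pos F u ≤ L.pos F v
    before⁻ F = does-true⁻ (_ ℕₚ.≤? _)

    not-before⁻ : ∀ {u v} F → not (before u v F) ≡ true → ¬ L.pos F u ≤ L.pos F v
    not-before⁻ F = does-not⁻ (_ ℕₚ.≤? _)

    ≼-trans : ∀ {u v w} → u ≼ v → v ≼ w → u ≼ w
    ≼-trans {u} {v} {w} (lift p) (lift q) = lift (decidable-stable (before u w ∈ᵇ? U) λ r →
      case realise (p ∷ q ∷ complement r ∷ []) [] of λ where
        (F , _ , p′ ∷ q′ ∷ r′ ∷ []) → not-before⁻ F r′ (ℕₚ.≤-trans (before⁻ F p′) (before⁻ F q′)))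

    ≼-antisym : ∀ {u v} → u ≼ v → v ≼ u → u ≡ v
    ≼-antisym {u} {v} (lift p) (lift q) = case realise (p ∷ q ∷ []) (u ∷ v ∷ []) of λ where
      (F , ⊆F , p′ ∷ q′ ∷ []) → L.pos-inj F (⊆F (here refl)) (⊆F (there (here refl)))
        (ℕₚ.≤-antisym (before⁻ F p′) (before⁻ F q′))

    ≼-total : ∀ u v → u ≼ v ⊎ v ≼ u
    ≼-total u v with before u v ∈ᵇ? U | before v u ∈ᵇ? U
    ... | yes p | _     = inj₁ (lift p)
    ... | no _  | yes q = inj₂ (lift q)
    ... | no p  | no q  = case realise (complement p ∷ complement q ∷ []) [] of λ where
      (F , _ , p′ ∷ q′ ∷ []) → contradiction (ℕₚ.≰⇒≥ (not-before⁻ F p′)) (not-before⁻ F q′)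

    ≼-isTotalOrder : IsTotalOrder _≡_ _≼_
    ≼-isTotalOrder = record
      { isPartialOrder = record
        { isPreorder = record
          { isEquivalence = isEquivalence
          ; reflexive     = λ { {u} refl → [ (λ p → p) , (λ p → p) ]′ (≼-total u u) }
          ; trans         = ≼-trans
          }
        ; antisym = ≼-antisym
        }
      ; total = ≼-total
      }

    -- There are finitely many colours: if each were avoided by `v` for `U`-most `F`, some single
    -- `F` would leave `v` without a colour.
    colouring : ∀ v → ∃[ i ] colour v i ∈ᵇ U
    colouring v = decidable-stable (Finₚ.any? λ i → colour v i ∈ᵇ? U) λ none →
      let F , _ , all = realise (Allₚ.tabulate⁺ {f = λ i → not ∘ colour v i}
            λ i → complement λ p → none (i , p)) []
      in does-not⁻ (L.χ F v Finₚ.≟ L.χ F v) (Allₚ.tabulate⁻ all (L.χ F v)) refl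

    χ : Vertex → Fin k
    χ = proj₁ ∘ colouring

    -- The colour of the earlier end, whichever way the edge is oriented.
    φ : ∀ {u v} → Adj u v → Fin k
    φ {u} {v} _ = case before u v ∈ᵇ? U of λ where
      (yes _) → χ u
      (no _)  → χ v

    φ-≼ : ∀ {u v} → u ≼ v → (e : Adj u v) → φ e ≡ χ u
    φ-≼ {u} {v} (lift p) e with before u v ∈ᵇ? U
    ... | yes _ = refl
    ... | no q  = contradiction p q

    φ-≽ : ∀ {u v} → v ≼ u → (e : Adj u v) → φ e ≡ χ v
    φ-≽ {u} {v} v≼u e with before u v ∈ᵇ? U
    ... | yes p = cong χ (≼-antisym (lift p) v≼u)
    ... | no _  = refl

    stackLayout : StackLayout G k
    stackLayout = record
      { _≼_          = _≼_
      ; isTotalOrder = ≼-isTotalOrder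
      ; φ            = φ
      ; φ-edge       = λ {u} {v} e e′ → case ≼-total u v of λ where
          (inj₁ u≼v) → trans (φ-≼ u≼v e) (sym (φ-≽ u≼v e′))
          (inj₂ v≼u) → trans (φ-≽ v≼u e) (sym (φ-≼ v≼u e′))
      -- The three order relations and the colours of `u` and `v` are realised at one `F` containing
      -- all four vertices, where the crossing contradicts the finite layout.
      ; noCrossing   = λ {u} {v} {x} {y} ux vy (u≼v , u≢v) (v≼x , v≢x) (x≼y , x≢y) eq →
          case realise (lower u≼v ∷ lower v≼x ∷ lower x≼y ∷ proj₂ (colouring u) ∷ proj₂ (colouring v) ∷ [])
            (u ∷ v ∷ x ∷ y ∷ []) of λ where
          (F , ⊆F , uv ∷ vx ∷ xy ∷ cu ∷ cv ∷ []) →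
            let u∈F = ⊆F (here refl)
                v∈F = ⊆F (there (here refl))
                x∈F = ⊆F (there (there (here refl)))
                y∈F = ⊆F (there (there (there (here refl))))
            in L.good F u∈F v∈F x∈F y∈F
              (ℕₚ.≤∧≢⇒< (before⁻ F uv) (u≢v ∘ L.pos-inj F u∈F v∈F))
              (ℕₚ.≤∧≢⇒< (before⁻ F vx) (v≢x ∘ L.pos-inj F v∈F x∈F))
              (ℕₚ.≤∧≢⇒< (before⁻ F xy) (x≢y ∘ L.pos-inj F x∈F y∈F))
              ux vy
              (trans (does-true⁻ (_ Finₚ.≟ _) cu)
                (trans (sym (φ-≼ (≼-trans u≼v v≼x) ux))
                  (trans eq (trans (φ-≼ (≼-trans v≼x x≼y) vy)
                    (sym (does-true⁻ (_ Finₚ.≟ _) cv))))))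
      }

-- Duplicate-free lists and least natural numbers.

lookup-injective : ∀ {A : Set ℓ} {xs : List A} → Unique xs → Injective _≡_ _≡_ (List.lookup xs)
lookup-injective (_ ∷ _)      {zero}  {zero}  eq = refl
lookup-injective (x∉ ∷ _)     {zero}  {suc j} eq = contradiction eq (All.lookup x∉ (∈-lookup j))
lookup-injective (x∉ ∷ _)     {suc i} {zero}  eq = contradiction (sym eq) (All.lookup x∉ (∈-lookup i))
lookup-injective (_ ∷ unique) {suc i} {suc j} eq = cong suc (lookup-injective unique eq)

least : {P : ℕ → Set ℓ} → (∀ n → Dec (P n)) → ∀ n → P n →
  ∃[ m ] (P m × (∀ j → P j → m ≤ j))
least {P = P} P? n Pn with search (suc n)
  where
  search : ∀ n → (∃[ m ] (P m × (∀ j → P j → m ≤ j))) ⊎ (∀ j → P j → n ≤ j)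
  search zero = inj₂ λ _ _ → z≤n
  search (suc n) with search n
  ... | inj₁ found = inj₁ found
  ... | inj₂ lower with P? n
  ...   | yes Pn = inj₁ (n , Pn , lower)
  ...   | no ¬Pn = inj₂ λ j Pj → ℕₚ.≤∧≢⇒< (lower j Pj) λ { refl → ¬Pn Pj }
... | inj₁ found = found
... | inj₂ lower = contradiction (lower n Pn) (ℕₚ.<⇒≱ (ℕₚ.n<1+n n))

-- From the infinite graph to its finite subgraphs

walk-snoc : ∀ {V : Set ℓ} {E : V → V → Set ℓ} {n u v w} → Walk E n u v → E v w → Walk E (suc n) u w
walk-snoc nil        e = cons e nil
walk-snoc (cons d p) e = cons d (walk-snoc p e)

module _ (G : Graph ℓ) where
  open Graph G

  LinearlyGrowing : ℕ → Set _
  LinearlyGrowing C = ∀ (H : Subgraph G) r m → 1 ≤ r → RadiusAtMost H r →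
    HasCardinality (Subgraph.InV H) [ m ] → m ≤ C * r

  module _ (em : ExcludedMiddle ℓ) where

    em₀ : ∀ {A : Set} → Dec A
    em₀ {A} = map′ lower lift (em {Lift ℓ A})

    module Finite {n} (e : Fin n → Vertex) (e-inj : Injective _≡_ _≡_ e)
      {C} (growing : LinearlyGrowing C) (1≤C : 1 ≤ C) where

      Adjₑ : Fin n → Fin n → Set ℓ
      Adjₑ i j = Adj (e i) (e j)

      open FiniteGraph Adjₑ (λ _ _ → em) Adj-sym

      -- The induced subgraph of `G` on the vertices numbered by `Q`, through which the growth of
      -- `G` bounds finite balls.
      image : Subset n → Subgraph G
      image Q = record
        { InV   = In
        ; InE   = λ u v → In u × In v × Adj u v
        ; E-sym = λ (i , j , a) → j , i , Adj-sym a
        ; E⊆Adj = λ (_ , _ , a) → a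
        ; E⊆V×V = λ (i , j , _) → i , j
        }
        where
        In : Vertex → Set ℓ
        In v = ∃[ i ] (i ∈ Q × e i ≡ v)

      image-card : ∀ Q → HasCardinality (Subgraph.InV (image Q)) [ ∣ Q ∣ ]
      image-card Q = let g , g-inj , g∈Q , onto = enumerate Q in
        e ∘ g , g-inj ∘ e-inj , λ v → mk⇔
          (λ (i , i∈Q , eq) → let j , gj≡i = onto i∈Q in j , trans (cong e gj≡i) eq)
          (λ (j , eq) → g j , g∈Q j , eq)

      -- The subgraph is fixed at radius `r` while the induction runs over `s`, so that all the
      -- walks live in the one subgraph whose radius is being bounded.
      ball-walk : ∀ {P v x} r s → s ≤ r → x ∈ ball P v s →
        DistanceAtMost (image (ball P v r)) s (e v) (e x)
      ball-walk {v = v} r zero s≤r x∈ with refl ← x∈⁅y⁆⇒x≡y v x∈ = 0 , z≤n , nil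
      ball-walk {P} {v} {x} r (suc s) s<r x∈ with ball-suc⁻ {P = P} {r = s} x∈
      ... | inj₁ x∈′ = let n , n≤s , p = ball-walk {P} r s (ℕₚ.<⇒≤ s<r) x∈′ in n , ℕₚ.m≤n⇒m≤1+n n≤s , p
      ... | inj₂ (x∈P , y , y∈ , yx) =
        let n , n≤s , p = ball-walk {P} r s (ℕₚ.<⇒≤ s<r) y∈ in
        suc n , s≤s n≤s , walk-snoc p
          ( (y , ball-mono (ℕₚ.<⇒≤ s<r) y∈ , refl)
          , (x , ball-mono s<r x∈ , refl)
          , yx)

      ball-growth : ∀ {P v r} → v ∈ P → 1 ≤ r → ∣ ball P v r ∣ ≤ C * r
      ball-growth {P} {v} {r} v∈P 1≤r = growing (image (ball P v r)) r _ 1≤r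
        ( e v , (v , centre∈ball {r = r} , refl)
        , λ { _ (x , x∈ , refl) → ball-walk {P} r r ℕₚ.≤-refl x∈ })
        (image-card (ball P v r))

      open LinearGrowth C ball-growth em₀ public using (k; s; K)
      open LinearGrowth C ball-growth em₀ using (eliminate)

      0<K : 0 < K
      0<K = ℕₚ.≤-trans 1≤C (ℕₚ.≤-trans (ℕₚ.m≤m+n C _) (ℕₚ.m≤n+m s k))

      layoutₑ : Layout {K = K} Subset.⊤ Subset.⊥ _
      -- The root bag is empty, so the initial colouring is arbitrary and vacuously rainbow.
      layoutₑ = elim⇒layout (λ _ → ∈⊤) (λ _ → fromℕ< 0<K) (λ i → contradiction i ∉⊥)
        (eliminate 1≤C _ ⊥⊆ (subst (_≤ k) (sym (∣⊥∣≡0 n)) z≤n) (ℕₚ.n<1+n _))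

    finiteLayout : ∀ {C} → 1 ≤ C → LinearlyGrowing C → ∀ F →
      FiniteLayout G (5 * C * (2 * C) + 2 * C + 2 * C) F
    finiteLayout {C} 1≤C growing F = record
      { pos     = pos
      ; pos-inj = λ u∈F v∈F eq → trans (sym (e-at u∈F)) (trans
          (cong e (L.pos-inj ∈⊤ ∉⊥ ∈⊤ ∉⊥
            (trans (sym (pos-at u∈F)) (trans eq (pos-at v∈F)))))
          (e-at v∈F))
      ; χ       = χ
      ; good    = λ u∈F v∈F x∈F y∈F u<v v<x x<y ux vy eq →
          L.good ∈⊤ ∈⊤ ∉⊥ ∈⊤ ∉⊥ ∈⊤ ∉⊥
            (inj₂ (subst₂ _<_ (pos-at u∈F) (pos-at v∈F) u<v))
            (subst₂ _<_ (pos-at v∈F) (pos-at x∈F) v<x)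
            (subst₂ _<_ (pos-at x∈F) (pos-at y∈F) x<y)
            (subst₂ Adj (sym (e-at u∈F)) (sym (e-at x∈F)) ux)
            (subst₂ Adj (sym (e-at v∈F)) (sym (e-at y∈F)) vy)
            (trans (sym (χ-at u∈F)) (trans eq (χ-at v∈F)))
      }
      where
      _≟_ : ∀ u v → Dec (u ≡ v)
      _ ≟ _ = em
      -- Without repetitions, the lookup function `e` is injective.
      F′ = List.deduplicate _≟_ F
      e = List.lookup F′
      module Fin-F = Finite e (lookup-injective (deduplicate-! _≟_ F)) growing 1≤C
      module L = FiniteGraph.Layout Fin-F.layoutₑ

      index : Vertex → Maybe (Fin (List.length F′))
      index v = case em {v ∈ₗ F′} of λ where
        (yes i) → just (Any.index i)
        (no _)  → nothing

      at : ∀ {v} → v ∈ₗ F → ∃[ i ] (index v ≡ just i × e i ≡ v)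
      at {v} v∈F with em {v ∈ₗ F′}
      ... | yes i = Any.index i , refl , sym (lookup-index i)
      ... | no v∉ = contradiction (∈-deduplicate⁺ _≟_ v∈F) v∉

      e-at : ∀ {v} (v∈F : v ∈ₗ F) → e (proj₁ (at v∈F)) ≡ v
      e-at = proj₂ ∘ proj₂ ∘ at

      pos : Vertex → ℕ
      -- The default 0 is taken only off `F`, where positions do not matter.
      pos = maybe′ L.pos 0 ∘ index

      χ : Vertex → Fin Fin-F.K
      χ = maybe′ L.χ (fromℕ< Fin-F.0<K) ∘ index

      pos-at : ∀ {v} (v∈F : v ∈ₗ F) → pos v ≡ L.pos (proj₁ (at v∈F))
      pos-at = cong (maybe′ L.pos 0) ∘ proj₁ ∘ proj₂ ∘ at

      χ-at : ∀ {v} (v∈F : v ∈ₗ F) → χ v ≡ L.χ (proj₁ (at v∈F))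
      χ-at = cong (maybe′ L.χ (fromℕ< Fin-F.0<K)) ∘ proj₁ ∘ proj₂ ∘ at

    -- StackLayout G k lives one universe above the reach of excluded middle;
    -- a Boolean-valued order brings it down.
    module _ where
      open Classical em

      IsStackLayout : ℕ → (Vertex → Vertex → Set ℓ) → Set ℓ
      IsStackLayout k _≼_ = IsTotalOrder _≡_ _≼_ ×
        Σ[ φ ∈ (∀ {u v} → Adj u v → Fin k) ]
          ((∀ {u v} (a : Adj u v) (a′ : Adj v u) → φ a ≡ φ a′) ×
          (∀ {u v x y} (ux : Adj u x) (vy : Adj v y) →
            u ≼ v × u ≢ v → v ≼ x × v ≢ x → x ≼ y × x ≢ y → φ ux ≢ φ vy))

      BooleanLayout : ℕ → Set ℓ
      BooleanLayout k = Σ[ le ∈ (Vertex → Vertex → Bool) ]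
        IsStackLayout k (λ u v → Lift ℓ (le u v ≡ true))

      fromBoolean : ∀ {k} → BooleanLayout k → StackLayout G k
      fromBoolean (le , order , φ , φ-edge , noCrossing) = record
        { _≼_ = λ u v → Lift ℓ (le u v ≡ true) ; isTotalOrder = order
        ; φ = φ ; φ-edge = φ-edge ; noCrossing = noCrossing }

      toBoolean : ∀ {k} → StackLayout G k → BooleanLayout k
      toBoolean L = (λ u v → ⟦ u ≼ v ⟧) , record
        { isPartialOrder = record
          { isPreorder = record
            { isEquivalence = isEquivalence
            ; reflexive     = λ eq → ≼⁺ (O.reflexive eq)
            ; trans         = λ p q → ≼⁺ (O.trans (≼⁻ p) (≼⁻ q))
            }
          ; antisym = λ p q → O.antisym (≼⁻ p) (≼⁻ q)
          }
        ; total = λ u v → Sum.map ≼⁺ ≼⁺ (O.total u v)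
        } , φ , φ-edge , λ ux vy (p , u≢v) (q , v≢x) (r , x≢y) →
          noCrossing ux vy (≼⁻ p , u≢v) (≼⁻ q , v≢x) (≼⁻ r , x≢y)
        where
        open StackLayout L
        module O = IsTotalOrder isTotalOrder
        ≼⁺ : ∀ {u v} → u ≼ v → Lift ℓ (⟦ u ≼ v ⟧ ≡ true)
        ≼⁺ p = lift (⟦⟧⁺ p)
        ≼⁻ : ∀ {u v} → Lift ℓ (⟦ u ≼ v ⟧ ≡ true) → u ≼ v
        ≼⁻ (lift p) = ⟦⟧⁻ p

    stackNumber : ∀ {k} → StackLayout G k → ∃[ s ] (IsStackNumber G [ s ] × s ≤ k)
    stackNumber {k} L =
      let s , layout , minimal = least (λ j → map′ fromBoolean toBoolean em) k L
      in s , (layout , minimal) , minimal k L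

-- Rational and real bounds

ι : ℕ → ℚ
ι k = ℤ.+ k ℚ./ 1

-- A denominator of 1 is already in lowest terms; in this normal form sums and products compute.
ι-mkℚ : ∀ k → ι k ≡ mkℚ (ℤ.+ k) 0 (Coprime.sym (Coprime.1-coprimeTo k))
ι-mkℚ k = ℚₚ.normalize-coprime (Coprime.sym (Coprime.1-coprimeTo k))

ι-+ : ∀ a b → ι (a + b) ≡ ι a ℚ.+ ι b
ι-+ a b = sym (trans (cong₂ ℚ._+_ (ι-mkℚ a) (ι-mkℚ b))
  (cong (ℚ._/ 1) (cong₂ ℤ._+_ (ℤₚ.*-identityʳ (ℤ.+ a)) (ℤₚ.*-identityʳ (ℤ.+ b)))))

ι-* : ∀ a b → ι (a * b) ≡ ι a ℚ.* ι b
ι-* a b = sym (trans (cong₂ ℚ._*_ (ι-mkℚ a) (ι-mkℚ b))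
  (cong (ℚ._/ 1) (sym (ℤₚ.pos-* a b))))

ι-mono-≤ : ∀ {a b} → a ≤ b → ι a ℚ.≤ ι b
ι-mono-≤ {a} {b} a≤b rewrite ι-mkℚ a | ι-mkℚ b =
  ℚ.*≤* (ℤₚ.*-monoʳ-≤-nonNeg (ℤ.+ 1) (ℤ.+≤+ a≤b))

ι-cancel-< : ∀ {a b} → ι a ℚ.< ι b → a < b
ι-cancel-< a<b = ℕₚ.≰⇒> λ b≤a → ℚₚ.<-irrefl refl (ℚₚ.<-≤-trans a<b (ι-mono-≤ b≤a))

ι-nonNeg : ∀ a → ℚ.NonNegative (ι a)
ι-nonNeg a = ℚ.nonNegative (ι-mono-≤ {0} {a} z≤n)

-- The absolute value of the numerator suffices, as the denominator is at least 1.
archimedean : ∀ q → ∃[ m ] q ℚ.≤ ι m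
archimedean q@(mkℚ n d _) = ℤ.∣ n ∣ , subst (q ℚ.≤_) (sym (ι-mkℚ ℤ.∣ n ∣)) (ℚ.*≤* (begin
  n ℤ.* ℤ.+ 1                 ≡⟨ ℤₚ.*-identityʳ n ⟩
  n                           ≤⟨ n≤∣n∣ n ⟩
  ℤ.+ ℤ.∣ n ∣                 ≤⟨ ℤ.+≤+ (ℕₚ.m≤m*n ℤ.∣ n ∣ (suc d)) ⟩
  ℤ.+ (ℤ.∣ n ∣ * suc d)       ≡⟨ ℤₚ.pos-* ℤ.∣ n ∣ (suc d) ⟩
  ℤ.+ ℤ.∣ n ∣ ℤ.* ℤ.+ suc d   ∎))
  where
  open ℤₚ.≤-Reasoning
  n≤∣n∣ : ∀ n → n ℤ.≤ ℤ.+ ℤ.∣ n ∣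
  n≤∣n∣ (ℤ.+ n)      = ℤₚ.≤-refl
  n≤∣n∣ (ℤ.-[1+ n ]) = ℤ.-≤+

-- Take the least natural number that is at least `q`: its predecessor, if there is one, is below
-- `q`.
natural-ceiling : ∀ q → 0ℚ ℚ.≤ q → ∃[ m ] (q ℚ.≤ ι m × ι m ℚ.≤ q ℚ.+ 1ℚ)
natural-ceiling q 0≤q with archimedean q
... | n , q≤n with least (λ m → q ℚₚ.≤? ι m) n q≤n
...   | zero  , q≤0 , _ = 0 , q≤0 , ℚₚ.≤-trans 0≤q
  (ℚₚ.≤-trans (ℚₚ.≤-reflexive (sym (ℚₚ.+-identityʳ q))) (ℚₚ.+-monoʳ-≤ q (ℚ.*≤* (ℤ.+≤+ z≤n))))
...   | suc m , q≤m , minimal = suc m , q≤m ,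
  subst (ℚ._≤ q ℚ.+ 1ℚ) (trans (sym (ι-+ m 1)) (cong ι (ℕₚ.+-comm m 1)))
    (ℚₚ.+-monoˡ-≤ 1ℚ (ℚₚ.<⇒≤ (ℚₚ.≰⇒> λ q≤m′ → ℕₚ.<⇒≱ (ℕₚ.n<1+n m) (minimal m q≤m′))))

⅛ ¾ 5/4 : ℚ
⅛ = ℤ.+ 1 ℚ./ 8
¾ = ℤ.+ 3 ℚ./ 4
5/4 = ℤ.+ 5 ℚ./ 4

0<⅛ : 0ℚ ℚ.< ⅛
0<⅛ = ℚₚ.positive⁻¹ ⅛

p-q<r⇒p≤q+r : ∀ {p q r} → ℚ.∣ p ℚ.- q ∣ ℚ.< r → p ℚ.≤ q ℚ.+ r
p-q<r⇒p≤q+r {p} {q} {r} lt = begin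
  p                      ≡⟨ solve 2 (λ p q → p := q :+ (p :- q)) refl p q ⟩
  q ℚ.+ (p ℚ.- q)        ≤⟨ ℚₚ.+-monoʳ-≤ q (p≤∣p∣ (p ℚ.- q)) ⟩
  q ℚ.+ ℚ.∣ p ℚ.- q ∣    ≤⟨ ℚₚ.+-monoʳ-≤ q (ℚₚ.<⇒≤ lt) ⟩
  q ℚ.+ r                ∎
  where
  open ℚₚ.≤-Reasoning
  open ℚ-Solver.+-*-Solver
  p≤∣p∣ : ∀ p → p ℚ.≤ ℚ.∣ p ∣
  p≤∣p∣ p = case ℚₚ.≤-total 0ℚ p of λ where
    (inj₁ 0≤p) → ℚₚ.≤-reflexive (sym (ℚₚ.0≤p⇒∣p∣≡p 0≤p))
    (inj₂ p≤0) → ℚₚ.≤-trans p≤0 (ℚₚ.0≤∣p∣ p)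

module _ (c : ℝ) (1≤c : fromℕ 1 ≤ᴿ c) where

  -- From `N` on, terms differ by less than `⅛`, so the ceiling `C` of the `N`-th term plus `⅛`
  -- bounds them all. It exceeds each by at most `⅛ + ⅛ + 1`, which is `5/4`.
  integer-bound : ∃[ C ] (1 ≤ C × ∃[ N ] (∀ n → N ≤ n →
    seq c n ℚ.≤ ι C × ι C ℚ.≤ seq c n ℚ.+ 5/4 × ¾ ℚ.≤ seq c n))
  integer-bound = C , 1≤C , N , λ n N≤n → c≤C n N≤n , C≤c n N≤n , ¾≤c n N≤n
    where
    N₁ = proj₁ (cauchy c ⅛ 0<⅛)
    N₂ = proj₁ (1≤c ⅛ 0<⅛)
    N = N₁ ⊔ N₂
    q = seq c N ℚ.+ ⅛
    near : ∀ m n → N ≤ m → N ≤ n → seq c m ℚ.≤ seq c n ℚ.+ ⅛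
    near m n N≤m N≤n = p-q<r⇒p≤q+r (proj₂ (cauchy c ⅛ 0<⅛) m n
      (ℕₚ.m⊔n≤o⇒m≤o N₁ N₂ N≤m) (ℕₚ.m⊔n≤o⇒m≤o N₁ N₂ N≤n))
    1≤c+⅛ : ∀ n → N ≤ n → 1ℚ ℚ.≤ seq c n ℚ.+ ⅛
    1≤c+⅛ n N≤n = proj₂ (1≤c ⅛ 0<⅛) n (ℕₚ.m⊔n≤o⇒n≤o N₁ N₂ N≤n)
    1≤q : 1ℚ ℚ.≤ q
    1≤q = 1≤c+⅛ N ℕₚ.≤-refl
    ceil = natural-ceiling q (ℚₚ.≤-trans (ℚ.*≤* (ℤ.+≤+ z≤n)) 1≤q)
    C = proj₁ ceil
    1≤C : 1 ≤ C
    1≤C = ι-cancel-< (ℚₚ.<-≤-trans (ℚₚ.positive⁻¹ 1ℚ) (ℚₚ.≤-trans 1≤q (proj₁ (proj₂ ceil))))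
    c≤C : ∀ n → N ≤ n → seq c n ℚ.≤ ι C
    c≤C n N≤n = ℚₚ.≤-trans (near n N N≤n ℕₚ.≤-refl) (proj₁ (proj₂ ceil))
    open ℚₚ.≤-Reasoning
    C≤c : ∀ n → N ≤ n → ι C ℚ.≤ seq c n ℚ.+ 5/4
    C≤c n N≤n = begin
      ι C                            ≤⟨ proj₂ (proj₂ ceil) ⟩
      seq c N ℚ.+ ⅛ ℚ.+ 1ℚ           ≤⟨ ℚₚ.+-monoˡ-≤ 1ℚ (ℚₚ.+-monoˡ-≤ ⅛ (near N n ℕₚ.≤-refl N≤n)) ⟩
      seq c n ℚ.+ ⅛ ℚ.+ ⅛ ℚ.+ 1ℚ     ≡⟨ solve 1 (λ x → x :+ con ⅛ :+ con ⅛ :+ con 1ℚ := x :+ con 5/4) refl (seq c n) ⟩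
      seq c n ℚ.+ 5/4                ∎
      where open ℚ-Solver.+-*-Solver
    ¾≤c : ∀ n → N ≤ n → ¾ ℚ.≤ seq c n
    ¾≤c n N≤n = begin
      -- Cross-multiplied, `¾ ≤ 7/8` reads `24 ≤ 28`.
      ¾                        ≤⟨ ℚ.*≤* (ℤ.+≤+ (ℕₚ.m≤m+n 24 4)) ⟩
      1ℚ ℚ.- ⅛                 ≤⟨ ℚₚ.+-monoˡ-≤ (ℚ.- ⅛) (1≤c+⅛ n N≤n) ⟩
      seq c n ℚ.+ ⅛ ℚ.- ⅛      ≡⟨ solve 1 (λ x → x :+ con ⅛ :- con ⅛ := x) refl (seq c n) ⟩
      seq c n                  ∎
      where open ℚ-Solver.+-*-Solver

-- The order on reals gives `p ≤ C * r` only up to an error; an error of `½` is less than 1 and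
-- hence harmless between integers.
≤ᴿ-integer : ∀ {c C N} → (∀ n → N ≤ n → seq c n ℚ.≤ ι C) → ∀ {p r} →
  fromℕ p ≤ᴿ c *ᴿ fromℕ r → p ≤ C * r
≤ᴿ-integer {c} {C} {N} c≤C {p} {r} le = ℕₚ.≤-pred (ι-cancel-< (begin-strict
  ι p                          ≤⟨ proj₂ (le ½ 0<½) n₀ (ℕₚ.m≤n⊔m N M) ⟩
  seq c n₀ ℚ.* ι r ℚ.+ ½        ≤⟨ ℚₚ.+-monoˡ-≤ ½ (ℚₚ.*-monoʳ-≤-nonNeg (ι r) {{ι-nonNeg r}} (c≤C n₀ (ℕₚ.m≤m⊔n N M))) ⟩
  ι C ℚ.* ι r ℚ.+ ½            <⟨ ℚₚ.+-monoʳ-< (ι C ℚ.* ι r) (ℚ.*<* (ℤ.+<+ (s≤s (s≤s z≤n)))) ⟩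
  ι C ℚ.* ι r ℚ.+ 1ℚ           ≡⟨ cong (ℚ._+ 1ℚ) (ι-* C r) ⟨
  ι (C * r) ℚ.+ 1ℚ             ≡⟨ ι-+ (C * r) 1 ⟨
  ι (C * r + 1)                ≡⟨ cong ι (ℕₚ.+-comm (C * r) 1) ⟩
  ι (suc (C * r))              ∎))
  where
  open ℚₚ.≤-Reasoning
  0<½ : 0ℚ ℚ.< ½
  0<½ = ℚₚ.positive⁻¹ ½
  M = proj₁ (le ½ 0<½)
  n₀ = N ⊔ M

-- The left side increases with `y ≥ 0`, so `y = x + 5/4` is the worst case; there the gap is a
-- polynomial in `x - ¾` with positive coefficients.
quadratic : ∀ {x y} → ¾ ℚ.≤ x → 0ℚ ℚ.≤ y → y ℚ.≤ x ℚ.+ 5/4 →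
  ι 10 ℚ.* (y ℚ.* y) ℚ.+ ι 4 ℚ.* y ℚ.≤ ι 49 ℚ.* (x ℚ.* x) ℚ.+ ι 30 ℚ.* x ℚ.+ ι 1
quadratic {x} {y} ¾≤x 0≤y y≤z = begin
  ι 10 ℚ.* (y ℚ.* y) ℚ.+ ι 4 ℚ.* y
    ≤⟨ ℚₚ.+-mono-≤ (ℚₚ.*-monoˡ-≤-nonNeg (ι 10) (ℚₚ.≤-trans
         (ℚₚ.*-monoʳ-≤-nonNeg y {{ℚ.nonNegative 0≤y}} y≤z)
         (ℚₚ.*-monoˡ-≤-nonNeg z {{ℚ.nonNegative (ℚₚ.≤-trans 0≤y y≤z)}} y≤z)))
         (ℚₚ.*-monoˡ-≤-nonNeg (ι 4) y≤z) ⟩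
  ι 10 ℚ.* (z ℚ.* z) ℚ.+ ι 4 ℚ.* z
    ≡⟨ ℚₚ.+-identityʳ _ ⟨
  ι 10 ℚ.* (z ℚ.* z) ℚ.+ ι 4 ℚ.* z ℚ.+ 0ℚ
    ≤⟨ ℚₚ.+-monoʳ-≤ (ι 10 ℚ.* (z ℚ.* z) ℚ.+ ι 4 ℚ.* z) (ℚₚ.nonNegative⁻¹ gap {{gap≥0}}) ⟩
  ι 10 ℚ.* (z ℚ.* z) ℚ.+ ι 4 ℚ.* z ℚ.+ gap
    ≡⟨ solve 1 (λ x → con (ι 10) :* ((x :+ con 5/4) :* (x :+ con 5/4)) :+ con (ι 4) :* (x :+ con 5/4)
         :+ ((x :- con ¾) :* (con (ι 39) :* (x :- con ¾) :+ con a) :+ con b)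
         := con (ι 49) :* (x :* x) :+ con (ι 30) :* x :+ con (ι 1)) refl x ⟩
  ι 49 ℚ.* (x ℚ.* x) ℚ.+ ι 30 ℚ.* x ℚ.+ ι 1 ∎
  where
  open ℚₚ.≤-Reasoning
  open ℚ-Solver.+-*-Solver
  z = x ℚ.+ 5/4
  w = x ℚ.- ¾
  a = ℤ.+ 119 ℚ./ 2
  b = ℤ.+ 49 ℚ./ 16
  -- the difference of the two sides at y = x + 5/4, in powers of x − ¾
  gap = w ℚ.* (ι 39 ℚ.* w ℚ.+ a) ℚ.+ b
  w≥0 : ℚ.NonNegative w
  w≥0 = ℚ.nonNegative (subst (ℚ._≤ w) (ℚₚ.+-inverseʳ ¾) (ℚₚ.+-monoˡ-≤ (ℚ.- ¾) ¾≤x))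
  39w≥0 = ℚₚ.nonNeg*nonNeg⇒nonNeg (ι 39) w {{w≥0}}
  39w+a≥0 = ℚₚ.nonNeg+nonNeg⇒nonNeg (ι 39 ℚ.* w) {{39w≥0}} a
  gap≥0 : ℚ.NonNegative gap
  gap≥0 = ℚₚ.nonNeg+nonNeg⇒nonNeg (w ℚ.* (ι 39 ℚ.* w ℚ.+ a))
    {{ℚₚ.nonNeg*nonNeg⇒nonNeg w {{w≥0}} (ι 39 ℚ.* w ℚ.+ a) {{39w+a≥0}}}} b

stack-bound : ∀ {c C N} → (∀ n → N ≤ n → ι C ℚ.≤ seq c n ℚ.+ 5/4 × ¾ ℚ.≤ seq c n) →
  ∀ {s} → s ≤ 5 * C * (2 * C) + 2 * C + 2 * C →
  fromℕ s ≤ᴿ fromℕ 49 *ᴿ (c *ᴿ c) +ᴿ fromℕ 30 *ᴿ c +ᴿ fromℕ 1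
stack-bound {c} {C} {N} near {s} s≤K ε 0<ε = N , λ n N≤n → let x = seq c n in begin
  ι s                                  ≤⟨ ι-mono-≤ s≤K ⟩
  ι (5 * C * (2 * C) + 2 * C + 2 * C)  ≡⟨ cong ι (solve 1 (λ c → con 5 :* c :* (con 2 :* c) :+ con 2 :* c :+ con 2 :* c
                                             := con 10 :* (c :* c) :+ con 4 :* c) refl C) ⟩
  ι (10 * (C * C) + 4 * C)             ≡⟨ ι-+ (10 * (C * C)) (4 * C) ⟩
  ι (10 * (C * C)) ℚ.+ ι (4 * C)       ≡⟨ cong₂ ℚ._+_ (trans (ι-* 10 (C * C)) (cong (ι 10 ℚ.*_) (ι-* C C))) (ι-* 4 C) ⟩
  ι 10 ℚ.* (ι C ℚ.* ι C) ℚ.+ ι 4 ℚ.* ι C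
    ≤⟨ quadratic (proj₂ (near n N≤n)) (ι-mono-≤ {0} {C} z≤n) (proj₁ (near n N≤n)) ⟩
  ι 49 ℚ.* (x ℚ.* x) ℚ.+ ι 30 ℚ.* x ℚ.+ ι 1
    ≡⟨ ℚₚ.+-identityʳ _ ⟨
  ι 49 ℚ.* (x ℚ.* x) ℚ.+ ι 30 ℚ.* x ℚ.+ ι 1 ℚ.+ 0ℚ
    ≤⟨ ℚₚ.+-monoʳ-≤ (ι 49 ℚ.* (x ℚ.* x) ℚ.+ ι 30 ℚ.* x ℚ.+ ι 1) (ℚₚ.<⇒≤ 0<ε) ⟩
  ι 49 ℚ.* (x ℚ.* x) ℚ.+ ι 30 ℚ.* x ℚ.+ ι 1 ℚ.+ ε ∎
  where
  open ℚₚ.≤-Reasoning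
  open ℕ-Solver.+-*-Solver

≤∞ᴿ-integer : ∀ {c C N} → (∀ n → N ≤ n → seq c n ℚ.≤ ι C) → ∀ {m r} (b : ℕ∞) →
  [ m ] ≤∞ b → b ≤∞ᴿ c *ᴿ fromℕ r → m ≤ C * r
-- An infinite `b` is excluded, since `⊤⁺ ≤∞ᴿ x` is empty.
≤∞ᴿ-integer {c} {C} {N} c≤C {m} {r} [ p ] m≤p p≤cr =
  ℕₚ.≤-trans ([≤]-injective m≤p) (≤ᴿ-integer {c} {C} {N} c≤C {p} {r} p≤cr)

theorem2 : ∀ {ℓ : Level} → ExcludedMiddle ℓ → Extensionality ℓ ℓ →
    (c : ℝ) → fromℕ 1 ≤ᴿ c →
    (G : Graph ℓ) (f : ℕ → ℕ∞) → IsGrowth G f →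
    (∀ r → 1 ≤ r → f r ≤∞ᴿ c *ᴿ fromℕ r) →
    ∃[ s ] (IsStackNumber G s × s ≤∞ᴿ fromℕ 49 *ᴿ (c *ᴿ c) +ᴿ fromℕ 30 *ᴿ c +ᴿ fromℕ 1)
theorem2 {ℓ} em ext c 1≤c G f growth f≤ =
  let C , 1≤C , N , near = integer-bound c 1≤c in conclude C 1≤C N near
  where
  conclude : ∀ C → 1 ≤ C → ∀ N →
    (∀ n → N ≤ n → seq c n ℚ.≤ ι C × ι C ℚ.≤ seq c n ℚ.+ 5/4 × ¾ ℚ.≤ seq c n) →
    ∃[ s ] (IsStackNumber G s × s ≤∞ᴿ fromℕ 49 *ᴿ (c *ᴿ c) +ᴿ fromℕ 30 *ᴿ c +ᴿ fromℕ 1)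
  conclude C 1≤C N near = [ proj₁ result ] , proj₁ (proj₂ result) ,
    stack-bound {c} {C} {N} (λ n N≤n → proj₂ (near n N≤n)) {proj₁ result} (proj₂ (proj₂ result))
    where
    growing : LinearlyGrowing G C
    growing H r m 1≤r radius card = ≤∞ᴿ-integer {c} {C} {N} (λ n N≤n → proj₁ (near n N≤n)) (f r)
      (proj₁ (growth r) [ m ] (H , radius , card)) (f≤ r 1≤r)
    result : ∃[ s ] (IsStackNumber G [ s ] × s ≤ 5 * C * (2 * C) + 2 * C + 2 * C)
    result = stackNumber G em
      (Compactness.stackLayout G em (lower-extensionality ℓ ℓ ext) (finiteLayout G em 1≤C growing))
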